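{- Let $A\in\mathbb{R}^{n\times n}$ with diagonal $\bm{A}_d=(A_{11},\dots,A_{nn})\neq\bm{0}$, let $\bar\varepsilon>0$ and $\delta\in(0,1)$, and let $s$ be a positive integer with $$s > 2\left(\frac{\|A\|_F^2-\|\bm{A}_d\|_2^2}{\|\bm{A}_d\|_2^2}\right)\frac{\ln(2n/\delta)}{\bar\varepsilon^2}.$$ Let $\bm{R}^s$ be the Rademacher diagonal estimator of $A$ with $s$ queries. Then $$\Pr\big(\|\bm{R}^s-\bm{A}_d\|_2\le\bar\varepsilon\|\bm{A}_d\|_2\big)\ge 1-\delta.$$
   Context: The Rademacher diagonal estimator of $A\in\mathbb{R}^{n\times n}$ with $s$ queries is the random vector $\bm{R}^s=\frac1s\sum_{k=1}^s \bm{v}_k\odot A\bm{v}_k\in\mathbb{R}^n$, where $\bm{v}_1,\dots,\bm{v}_s$ are independent random vectors in $\mathbb{R}^n$ whose entries are i.i.d. Rademacher variables (values $\pm1$ with probability $1/2$ each), and $\odot$ denotes component-wise multiplication. $\|\cdot\|_2$ is the Euclidean norm and $\|\cdot\|_F$ the Frobenius norm. -}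

module Defs where

open import Algebra.Bundles using (CommutativeRing)
open import Data.Fin.Base using (Fin; toℕ)
open import Data.Nat.Base as ℕ using (ℕ)
open import Data.Product.Base using (∃; _×_)
open import Data.Sign.Base using (Sign)
open import Data.Vec.Functional using (Vector; zipWith)
open import Level using (0ℓ) renaming (suc to lsuc)
open import Relation.Binary.Core using (Rel)
open import Relation.Binary.PropositionalEquality.Core using (_≡_; _≢_)
open import Relation.Binary.Structures using (IsDecTotalOrder)
import Relation.Binary.Construct.NonStrictToStrict as NonStrictToStrict
open import Relation.Nullary.Negation.Core using (¬_)
open import Relation.Unary using (Pred; U; ∁; ⋃; _≐_; _⊥_)

-- The classical real numbers, characterised up to isomorphism as a
-- Dedekind-complete ordered field.  As usual in classical mathematics
-- the order is decidable, and inverse and supremum are total operations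
-- with unspecified values at 0# and at sets that are empty or unbounded.
record Reals : Set₁ where
  field
    commutativeRing : CommutativeRing 0ℓ 0ℓ

  open CommutativeRing commutativeRing public

  infix 4 _≤_
  infix 8 _⁻¹

  field
    0≉1             : ¬ (0# ≈ 1#)
    _⁻¹             : Carrier → Carrier
    ⁻¹-cong         : ∀ {x y} → x ≈ y → x ⁻¹ ≈ y ⁻¹
    ⁻¹-inverseʳ     : ∀ x → ¬ (x ≈ 0#) → x * x ⁻¹ ≈ 1#
    _≤_             : Rel Carrier 0ℓ
    isDecTotalOrder : IsDecTotalOrder _≈_ _≤_
    +-monoʳ-≤       : ∀ x {y z} → y ≤ z → x + y ≤ x + z
    *-nonNegative   : ∀ {x y} → 0# ≤ x → 0# ≤ y → 0# ≤ x * y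

  UpperBound : Pred Carrier 0ℓ → Pred Carrier 0ℓ
  UpperBound P b = ∀ x → P x → x ≤ b

  field
    sup       : Pred Carrier 0ℓ → Carrier
    sup-upper : ∀ P → ∃ P → ∃ (UpperBound P) → UpperBound P (sup P)
    sup-least : ∀ P → ∃ P → ∃ (UpperBound P) → ∀ b → UpperBound P b → sup P ≤ b

module RealAnalysis (ℝ : Reals) where

  open Reals ℝ public
    hiding (zero)
    renaming (Carrier to R)
  open NonStrictToStrict _≈_ _≤_ public using (_<_)
  open import Algebra.Properties.Semiring.Exp semiring public using (_^_)
  open import Algebra.Properties.Monoid.Sum +-monoid public using (sum; sum-syntax)
  open import Algebra.Properties.Monoid.Sum *-monoid public using () renaming (sum to prod)
  import Algebra.Properties.Monoid.Mult +-monoid as Mult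

  infixl 7 _/_
  infixl 6 _-ᵥ_
  infixl 7 _*ᵥ_ _⊙_
  infix 4 _⟶_

  _/_ : R → R → R
  x / y = x * y ⁻¹

  fromℕ : ℕ → R
  fromℕ n = n Mult.× 1#

  _⟶_ : (ℕ → R) → R → Set
  a ⟶ l = ∀ ε → 0# < ε →
    ∃ λ N → ∀ m → N ℕ.≤ m → (- ε < a m - l) × (a m - l < ε)

  -- Limits are unique, so for a convergent sequence this is the supremum
  -- of a singleton, i.e. "the" limit.
  lim : (ℕ → R) → R
  lim a = sup (a ⟶_)

  exp : R → R
  exp x = lim λ m → ∑[ k < m ] (x ^ toℕ k / fromℕ (toℕ k ℕ.!))

  -- For 0# < x: exp is continuous and strictly increasing onto the positive
  -- reals, so this supremum is the unique y with exp y ≈ x.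
  ln : R → R
  ln x = sup λ y → exp y ≤ x

  -- For 0# ≤ x: the unique y with 0# ≤ y and y * y ≈ x.
  sqrt : R → R
  sqrt x = sup λ y → y * y ≤ x

  Matrix : ℕ → ℕ → Set
  Matrix m n = Fin m → Fin n → R

  diag : ∀ {n} → Matrix n n → Vector R n
  diag A i = A i i

  _*ᵥ_ : ∀ {m n} → Matrix m n → Vector R n → Vector R m
  _*ᵥ_ {n = n} A v i = ∑[ j < n ] (A i j * v j)

  _⊙_ : ∀ {n} → Vector R n → Vector R n → Vector R n
  _⊙_ = zipWith _*_

  _-ᵥ_ : ∀ {n} → Vector R n → Vector R n → Vector R n
  _-ᵥ_ = zipWith _-_

  ‖_‖₂ : ∀ {n} → Vector R n → R
  ‖_‖₂ {n} v = sqrt (∑[ i < n ] (v i ^ 2))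

  ‖_‖F : ∀ {m n} → Matrix m n → R
  ‖_‖F {m} {n} A = sqrt (∑[ i < m ] ∑[ j < n ] (A i j ^ 2))

  -- ℙ is a function on all subsets, but constrained only on measurable ones.
  record ProbabilitySpace : Set₂ where
    field
      Ω             : Set
      Measurable    : Pred (Pred Ω 0ℓ) (lsuc 0ℓ)
      measurable-≐  : ∀ {E F} → E ≐ F → Measurable E → Measurable F
      measurable-U  : Measurable U
      measurable-∁  : ∀ {E} → Measurable E → Measurable (∁ E)
      measurable-⋃  : ∀ {E : ℕ → Pred Ω 0ℓ} → (∀ i → Measurable (E i)) →
                      Measurable (⋃ ℕ E)
      ℙ             : Pred Ω 0ℓ → R
      ℙ-cong        : ∀ {E F} → Measurable E → E ≐ F → ℙ E ≈ ℙ F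
      ℙ-nonNegative : ∀ {E} → Measurable E → 0# ≤ ℙ E
      ℙ-U           : ℙ U ≈ 1#
      ℙ-σ-additive  : ∀ {E : ℕ → Pred Ω 0ℓ} → (∀ i → Measurable (E i)) →
                      (∀ i j → i ≢ j → E i ⊥ E j) →
                      (λ m → ∑[ i < m ] ℙ (E (toℕ i))) ⟶ ℙ (⋃ ℕ E)

  fromSign : Sign → R
  fromSign Sign.+ = 1#
  fromSign Sign.- = - 1#

  module Estimator (𝒫 : ProbabilitySpace) where

    open ProbabilitySpace 𝒫 public

    -- V k i is (the sign of) the i-th entry of the k-th query vector.
    SignFamily : ℕ → ℕ → Set
    SignFamily s n = Fin s → Fin n → Ω → Sign

    -- All entries of all query vectors are jointly independent; as they
    -- are finitely valued, independence is the product formula for the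
    -- joint probability mass function.
    record IsIIDRademacher {s n} (V : SignFamily s n) : Set₁ where
      field
        measurable  : ∀ k i σ → Measurable (λ ω → V k i ω ≡ σ)
        uniform     : ∀ k i σ → ℙ (λ ω → V k i ω ≡ σ) ≈ 1# / fromℕ 2
        independent : ∀ (σ : Fin s → Fin n → Sign) →
          ℙ (λ ω → ∀ k i → V k i ω ≡ σ k i) ≈
          prod {s} λ k → prod {n} λ i → ℙ (λ ω → V k i ω ≡ σ k i)

    query : ∀ {s n} → SignFamily s n → Fin s → Ω → Vector R n
    query V k ω i = fromSign (V k i ω)

    rademacherEstimator : ∀ {s n} → Matrix n n → SignFamily s n → Ω → Vector R n
    rademacherEstimator {s} A V ω i =
      1# / fromℕ s * ∑[ k < s ] ((query V k ω ⊙ (A *ᵥ query V k ω)) i)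

{-# OPTIONS --safe #-}

-- Conditionally on the i-th signs of the queries, s times the i-th error is a sum of independent
-- signs with weights A i j (j ≠ i), so cosh y ≤ exp (y² / 2) and Chernoff's bound control it with
-- Gaussian tails.  Splitting the admissible squared error among the coordinates in proportion to
-- their variances gives every coordinate the same tail exp (- x), x = s ε̄² ‖diag A‖² / (2 Σ variance),
-- and the union bound over n coordinates and two tails costs the factor 2 n; the hypothesis on s says
-- exactly ln (2 n / δ) < x.
--
-- Constructively, Dedekind completeness yields no explicit witnesses for the Archimedean property
-- or for the convergence of the exponential series; the moduli of convergence contained in
-- σ-additivity give Markov's principle, which supplies them.
module Submission where

open import Defs
open import Algebra.Bundles using (RawRing)
import Algebra.Solver.Ring as RingSolver
open import Algebra.Solver.Ring.AlmostCommutativeRing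
open import Data.Empty using (⊥-elim)
open import Data.Fin.Base using (Fin; zero; suc; toℕ)
import Data.Fin.Properties as Fin
open import Data.Integer.Base as ℤ using (ℤ; +_; -[1+_]; _⊖_)
import Data.Integer.Properties as ℤ
open import Data.Maybe.Base using (Maybe; just; nothing)
open import Data.Nat.Base as ℕ using (ℕ; zero; suc; NonZero; _∸_; _!)
import Data.Nat.Properties as ℕ
open import Data.Product.Base using (∃; _×_; _,_; proj₁; proj₂)
open import Data.Sign.Base using (Sign)
import Data.Sign.Properties as Sign
open import Data.Sum.Base using (_⊎_; inj₁; inj₂; [_,_]′)
open import Data.Unit.Base using (tt)
open import Data.Vec.Functional using (Vector; _∷_; [])
open import Function.Base using (_∘_)
open import Level using (0ℓ)
open import Relation.Binary.Bundles using (Poset)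
import Relation.Binary.Construct.NonStrictToStrict as Strict
open import Relation.Binary.Definitions using (tri<; tri≈; tri>)
open import Relation.Binary.PropositionalEquality.Core as ≡ using (_≡_; _≢_)
import Relation.Binary.Reasoning.PartialOrder as PartialOrderReasoning
open import Relation.Binary.Structures using (IsDecTotalOrder)
open import Relation.Nullary using (Dec; yes; no; ¬?)
open import Relation.Nullary.Negation.Core using (¬_)
open import Relation.Unary using (Pred; U; ∅; ∁; ⋃; _≐_; _⊥_; _∩_; _∪_)

-- With row variance `v` and squared budget `τ v`, the Chernoff parameter `√(τ / v)` turns the
-- moment bound into `exp (s τ / 2)` and the value at the threshold into `exp (s τ)`. Both are free
-- of `v`, which is why the proportional split makes all coordinates alike. The value of `τ` is
-- forced by requiring the budgets to add up to the admissible squared error; it divides by the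
-- total variance, so a diagonal matrix has to be treated apart.
--
-- The union bound is carried by one function on sign matrices, a sum of `2 n` scaled exponentials
-- that is at least 1 wherever the estimate is too far off. Its average bounds the failure
-- probability, so only the probabilities of the cells of a finite partition have to be known, and
-- the same partition proves that the success event is measurable.
--
-- The bound on cosh is drawn from additivity of the exponential and the linear bounds
-- `1 + x ≤ exp x` and `(1 - u) exp u ≤ 1`. Near 0 these lose a factor slightly above 1 in the
-- exponent, hence a detour through all larger exponents.

MarkovPrinciple : Set₁
MarkovPrinciple = (Q : ℕ → Set) → (∀ n → Dec (Q n)) → ¬ ¬ ∃ Q → ∃ Q

-- Ordered field arithmetic, a ring solver with integer coefficients, uniqueness of limits

module OrderedField (ℝ : Reals) where

  open RealAnalysis ℝ
  import Algebra.Properties.Monoid.Mult +-monoid as Mult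
  import Algebra.Properties.Semiring.Mult semiring as SMult
  import Algebra.Properties.Ring ring as RingP
  open import Algebra.Properties.AbelianGroup +-abelianGroup public
    using ()
    renaming (⁻¹-∙-comm to -‿+-comm; ⁻¹-involutive to -‿involutive; ε⁻¹≈ε to -0≈0; x≈y⇒x∙y⁻¹≈ε to x≈y⇒x-y≈0)

  open IsDecTotalOrder isDecTotalOrder public
    using (_≟_; _≤?_; total; antisym)
    renaming (refl to ≤-refl; trans to ≤-trans; reflexive to ≤-reflexive)

  almostRing : AlmostCommutativeRing 0ℓ 0ℓ
  almostRing = fromCommutativeRing commutativeRing

  ℤ-rawRing : RawRing 0ℓ 0ℓ
  ℤ-rawRing = record { _≈_ = _≡_ ; _+_ = ℤ._+_ ; _*_ = ℤ._*_ ; -_ = ℤ.-_ ; 0# = ℤ.0ℤ ; 1# = ℤ.1ℤ }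

  fromℤ : ℤ → R
  fromℤ (+ n)    = fromℕ n
  fromℤ -[1+ n ] = - fromℕ (suc n)

  private
    -- The integer solver rests on this identity through `fromℤ-⊖`, so a solver with opaque
    -- coefficients does the rearranging here and `1# - 1#` is cancelled by hand.
    cancel-suc : ∀ x y → x - y ≈ (1# + x) - (1# + y)
    cancel-suc x y = begin
      x - y                       ≈⟨ +-identityˡ _ ⟨
      0# + (x - y)                ≈⟨ +-congʳ (-‿inverseʳ 1#) ⟨
      (1# - 1#) + (x - y)         ≈⟨ solve 4 (λ a b c d → (a :+ b) :+ (c :+ d) := (a :+ c) :+ (b :+ d)) refl 1# (- 1#) x (- y) ⟩
      (1# + x) + (- 1# - y)       ≈⟨ +-congˡ (-‿+-comm 1# y) ⟩
      (1# + x) - (1# + y)         ∎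
      where
      no-coeff≟ : (x y : R) → Maybe (x ≈ y)
      no-coeff≟ _ _ = nothing
      open RingSolver (AlmostCommutativeRing.rawRing almostRing) almostRing
        (-raw-almostCommutative⟶ almostRing) no-coeff≟
      open import Relation.Binary.Reasoning.Setoid setoid

  fromℤ-⊖ : ∀ m n → fromℤ (m ⊖ n) ≈ fromℕ m - fromℕ n
  fromℤ-⊖ m zero = sym (trans (+-congˡ -0≈0) (+-identityʳ _))
  fromℤ-⊖ zero (suc n) = sym (+-identityˡ _)
  fromℤ-⊖ (suc m) (suc n) = trans (reflexive (≡.cong fromℤ (ℤ.[1+m]⊖[1+n]≡m⊖n m n)))
    (trans (fromℤ-⊖ m n) (cancel-suc _ _))

  fromℤ-+ : ∀ i j → fromℤ (i ℤ.+ j) ≈ fromℤ i + fromℤ j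
  fromℤ-+ (+ m) (+ n) = Mult.×-homo-+ 1# m n
  fromℤ-+ (+ m) -[1+ n ] = fromℤ-⊖ m (suc n)
  fromℤ-+ -[1+ m ] (+ n) = trans (fromℤ-⊖ n (suc m)) (+-comm _ _)
  fromℤ-+ -[1+ m ] -[1+ n ] = trans (-‿cong (trans (+-congˡ (Mult.×-homo-+ 1# (suc m) n))
    (trans (sym (+-assoc _ _ _)) (trans (+-congʳ (+-comm _ _)) (+-assoc _ _ _))))) (sym (-‿+-comm _ _))

  fromℤ-neg : ∀ i → fromℤ (ℤ.- i) ≈ - fromℤ i
  fromℤ-neg (+ zero) = sym -0≈0
  fromℤ-neg (+ suc n) = refl
  fromℤ-neg -[1+ n ] = sym (-‿involutive _)

  fromℤ-*-+ : ∀ i n → fromℤ (i ℤ.* + n) ≈ fromℤ i * fromℕ n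
  fromℤ-*-+ (+ m) n = trans (reflexive (≡.cong fromℤ (≡.sym (ℤ.pos-* m n)))) (SMult.×1-homo-* m n)
  fromℤ-*-+ -[1+ m ] n = trans (reflexive (≡.cong fromℤ (≡.sym (ℤ.neg-distribˡ-* (+ suc m) (+ n)))))
    (trans (fromℤ-neg (+ suc m ℤ.* + n)) (trans (-‿cong (fromℤ-*-+ (+ suc m) n)) (RingP.-‿distribˡ-* _ _)))

  fromℤ-* : ∀ i j → fromℤ (i ℤ.* j) ≈ fromℤ i * fromℤ j
  fromℤ-* i (+ n) = fromℤ-*-+ i n
  fromℤ-* i -[1+ n ] = trans (reflexive (≡.cong fromℤ (≡.sym (ℤ.neg-distribʳ-* i (+ suc n)))))
    (trans (fromℤ-neg (i ℤ.* + suc n)) (trans (-‿cong (fromℤ-*-+ i (suc n))) (RingP.-‿distribʳ-* _ _)))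

  -- Agrees with fromℤ, but evaluates to 1# at 1, so that solver goals can mention 1#.
  coeff : ℤ → R
  coeff (+ 1) = 1#
  coeff i     = fromℤ i

  coeff≈fromℤ : ∀ i → coeff i ≈ fromℤ i
  coeff≈fromℤ (+ 0)           = refl
  coeff≈fromℤ (+ 1)           = sym (+-identityʳ 1#)
  coeff≈fromℤ (+ suc (suc n)) = refl
  coeff≈fromℤ -[1+ n ]        = refl

  coeff-morphism : ℤ-rawRing -Raw-AlmostCommutative⟶ almostRing
  coeff-morphism = record
    { ⟦_⟧    = coeff
    ; +-homo = λ i j → trans (coeff≈fromℤ (i ℤ.+ j)) (trans (fromℤ-+ i j) (sym (+-cong (coeff≈fromℤ i) (coeff≈fromℤ j))))
    ; *-homo = λ i j → trans (coeff≈fromℤ (i ℤ.* j)) (trans (fromℤ-* i j) (sym (*-cong (coeff≈fromℤ i) (coeff≈fromℤ j))))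
    ; -‿homo = λ i → trans (coeff≈fromℤ (ℤ.- i)) (trans (fromℤ-neg i) (sym (-‿cong (coeff≈fromℤ i))))
    ; 0-homo = refl
    ; 1-homo = refl
    }

  private
    _coeff≟_ : ∀ i j → Maybe (coeff i ≈ coeff j)
    i coeff≟ j with i ℤ.≟ j
    ... | yes i≡j = just (reflexive (≡.cong coeff i≡j))
    ... | no _    = nothing

  open RingSolver ℤ-rawRing almostRing coeff-morphism _coeff≟_ public
    using (Polynomial; solve; con; var; _:=_; _:+_; _:*_; _:-_; :-_; _:^_)

  infix 9 :1 :2
  :0 :1 :2 : ∀ {n} → Polynomial n
  :0 = con (+ 0)
  :1 = con (+ 1)
  :2 = con (+ 2)

  poset : Poset 0ℓ 0ℓ 0ℓ
  poset = record { isPartialOrder = IsDecTotalOrder.isPartialOrder isDecTotalOrder }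

  module ≤-Reasoning = PartialOrderReasoning poset

  ≰⇒> : ∀ {x y} → ¬ (x ≤ y) → y < x
  ≰⇒> = Strict.≰⇒> _≈_ _≤_ sym ≤-reflexive total

  ≰⇒≥ : ∀ {x y} → ¬ (x ≤ y) → y ≤ x
  ≰⇒≥ = proj₁ ∘ ≰⇒>

  <⇒≱ : ∀ {x y} → x < y → ¬ (y ≤ x)
  <⇒≱ = Strict.<⇒≱ _≈_ _≤_ antisym

  -- The order is decidable, so inequalities may be proved by contradiction; suprema and limits are
  -- handled this way throughout.
  ≤-stable : ∀ {x y} → ¬ ¬ (x ≤ y) → x ≤ y
  ≤-stable {x} {y} ¬¬x≤y with x ≤? y
  ... | yes x≤y = x≤y
  ... | no x≰y  = ⊥-elim (¬¬x≤y x≰y)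

  <-≤-trans : ∀ {x y z} → x < y → y ≤ z → x < z
  <-≤-trans x<y y≤z = ≰⇒> λ z≤x → <⇒≱ x<y (≤-trans y≤z z≤x)

  ≤-<-trans : ∀ {x y z} → x ≤ y → y < z → x < z
  ≤-<-trans x≤y y<z = ≰⇒> λ z≤x → <⇒≱ y<z (≤-trans z≤x x≤y)

  <-resp : ∀ {x x′ y y′} → x ≈ x′ → y ≈ y′ → x < y → x′ < y′
  <-resp x≈x′ y≈y′ x<y = ≤-<-trans (≤-reflexive (sym x≈x′)) (<-≤-trans x<y (≤-reflexive y≈y′))

  ≤-resp : ∀ {x x′ y y′} → x ≈ x′ → y ≈ y′ → x ≤ y → x′ ≤ y′
  ≤-resp x≈x′ y≈y′ x≤y = ≤-trans (≤-reflexive (sym x≈x′)) (≤-trans x≤y (≤-reflexive y≈y′))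

  +-mono-≤ : ∀ {x y u v} → x ≤ y → u ≤ v → x + u ≤ y + v
  +-mono-≤ {x} {y} {u} {v} x≤y u≤v = ≤-trans (+-monoʳ-≤ x u≤v)
    (≤-resp (+-comm v x) (+-comm v y) (+-monoʳ-≤ v x≤y))

  +-monoˡ-≤ : ∀ x {y z} → y ≤ z → y + x ≤ z + x
  +-monoˡ-≤ x y≤z = +-mono-≤ y≤z ≤-refl

  x≤x+y : ∀ {x y} → 0# ≤ y → x ≤ x + y
  x≤x+y {x} {y} 0≤y = ≤-resp (+-identityʳ x) refl (+-monoʳ-≤ x 0≤y)

  x≤y+x : ∀ {x y} → 0# ≤ y → x ≤ y + x
  x≤y+x 0≤y = ≤-trans (x≤x+y 0≤y) (≤-reflexive (+-comm _ _))

  ≤-from-difference : ∀ {x y z} → 0# ≤ z → y ≈ x + z → x ≤ y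
  ≤-from-difference 0≤z y≈x+z = ≤-trans (x≤x+y 0≤z) (≤-reflexive (sym y≈x+z))

  x≤y⇒0≤y-x : ∀ {x y} → x ≤ y → 0# ≤ y - x
  x≤y⇒0≤y-x {x} {y} x≤y = ≤-resp (-‿inverseˡ x) (+-comm (- x) y) (+-monoʳ-≤ (- x) x≤y)

  0≤y-x⇒x≤y : ∀ {x y} → 0# ≤ y - x → x ≤ y
  0≤y-x⇒x≤y {x} {y} 0≤y-x = ≤-from-difference 0≤y-x (solve 2 (λ x y → y := x :+ (y :- x)) refl x y)

  x<y⇒0<y-x : ∀ {x y} → x < y → 0# < y - x
  x<y⇒0<y-x {x} {y} x<y = ≰⇒> λ y-x≤0 → <⇒≱ x<y
    (≤-resp (solve 2 (λ x y → x :+ (y :- x) := y) refl x y) (+-identityʳ x) (+-monoʳ-≤ x y-x≤0))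

  -- Reduces every rearrangement of an inequality to a single solver identity between differences.
  ≤-via : ∀ {x y x′ y′} → y′ - x′ ≈ y - x → x ≤ y → x′ ≤ y′
  ≤-via eq x≤y = 0≤y-x⇒x≤y (≤-trans (x≤y⇒0≤y-x x≤y) (≤-reflexive (sym eq)))

  <-via : ∀ {x y x′ y′} → y′ - x′ ≈ y - x → x < y → x′ < y′
  <-via eq x<y = ≰⇒> λ y′≤x′ → <⇒≱ x<y (≤-via
    (trans (sym (neg-diff _ _)) (trans (-‿cong (sym eq)) (neg-diff _ _))) y′≤x′)
    where
    neg-diff : ∀ a b → - (a - b) ≈ b - a
    neg-diff = solve 2 (λ a b → :- (a :- b) := b :- a) refl

  -‿mono-≤ : ∀ {x y} → x ≤ y → - y ≤ - x
  -‿mono-≤ {x} {y} = ≤-via (solve 2 (λ x y → :- x :- :- y := y :- x) refl x y)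

  *-monoˡ-≤ : ∀ {x y z} → 0# ≤ x → y ≤ z → x * y ≤ x * z
  *-monoˡ-≤ {x} {y} {z} 0≤x y≤z = ≤-from-difference (*-nonNegative 0≤x (x≤y⇒0≤y-x y≤z))
    (solve 3 (λ x y z → x :* z := x :* y :+ x :* (z :- y)) refl x y z)

  *-monoʳ-≤ : ∀ {x y z} → 0# ≤ x → y ≤ z → y * x ≤ z * x
  *-monoʳ-≤ 0≤x y≤z = ≤-resp (*-comm _ _) (*-comm _ _) (*-monoˡ-≤ 0≤x y≤z)

  *-mono-≤ : ∀ {a b c d} → 0# ≤ b → 0# ≤ c → a ≤ b → c ≤ d → a * c ≤ b * d
  *-mono-≤ 0≤b 0≤c a≤b c≤d = ≤-trans (*-monoʳ-≤ 0≤c a≤b) (*-monoˡ-≤ 0≤b c≤d)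

  +-nonNegative : ∀ {x y} → 0# ≤ x → 0# ≤ y → 0# ≤ x + y
  +-nonNegative 0≤x 0≤y = ≤-trans 0≤x (x≤x+y 0≤y)

  0≤x*x : ∀ x → 0# ≤ x * x
  0≤x*x x with total 0# x
  ... | inj₁ 0≤x = *-nonNegative 0≤x 0≤x
  ... | inj₂ x≤0 = ≤-trans (*-nonNegative 0≤-x 0≤-x) (≤-reflexive (solve 1 (λ x → :- x :* :- x := x :* x) refl x))
    where 0≤-x = ≤-resp -0≈0 refl (-‿mono-≤ x≤0)

  0≤1 : 0# ≤ 1#
  0≤1 = ≤-trans (0≤x*x 1#) (≤-reflexive (*-identityˡ 1#))

  0<1 : 0# < 1#
  0<1 = 0≤1 , 0≉1

  +-pos-nonNegative : ∀ {x y} → 0# < x → 0# ≤ y → 0# < x + y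
  +-pos-nonNegative 0<x 0≤y = <-≤-trans 0<x (x≤x+y 0≤y)

  *-cancelˡ-≤ : ∀ {x y z} → 0# < x → x * y ≤ x * z → y ≤ z
  ⁻¹-pos : ∀ {x} → 0# < x → 0# < x ⁻¹

  ⁻¹-inverse : ∀ {x} → 0# < x → x * x ⁻¹ ≈ 1#
  ⁻¹-inverse {x} 0<x = ⁻¹-inverseʳ x (λ x≈0 → proj₂ 0<x (sym x≈0))

  ⁻¹-pos {x} 0<x = ≰⇒> λ x⁻¹≤0 → <⇒≱ 0<1
    (≤-resp (⁻¹-inverse 0<x) (zeroʳ x) (*-monoˡ-≤ (proj₁ 0<x) x⁻¹≤0))

  *-cancelˡ-≤ {x} {y} {z} 0<x xy≤xz = ≤-resp (cancel y) (cancel z) (*-monoˡ-≤ (proj₁ (⁻¹-pos 0<x)) xy≤xz)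
    where
    cancel : ∀ w → x ⁻¹ * (x * w) ≈ w
    cancel w = trans (sym (*-assoc _ _ _)) (trans (*-congʳ (trans (*-comm _ _) (⁻¹-inverse 0<x))) (*-identityˡ w))

  *-pos : ∀ {x y} → 0# < x → 0# < y → 0# < x * y
  *-pos {x} {y} 0<x 0<y = ≰⇒> λ xy≤0 → <⇒≱ 0<y (*-cancelˡ-≤ 0<x (≤-trans xy≤0 (≤-reflexive (sym (zeroʳ x)))))

  *-monoˡ-< : ∀ {x y z} → 0# < x → y < z → x * y < x * z
  *-monoˡ-< 0<x y<z = ≰⇒> λ xz≤xy → <⇒≱ y<z (*-cancelˡ-≤ 0<x xz≤xy)

  *-cancelˡ : ∀ {x y z} → 0# < x → x * y ≈ x * z → y ≈ z
  *-cancelˡ 0<x eq = antisym (*-cancelˡ-≤ 0<x (≤-reflexive eq)) (*-cancelˡ-≤ 0<x (≤-reflexive (sym eq)))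

  square-cancel-≤ : ∀ {x y} → 0# ≤ y → x * x ≤ y * y → x ≤ y
  square-cancel-≤ {x} {y} 0≤y x²≤y² with x ≤? y
  ... | yes x≤y = x≤y
  ... | no x≰y  = ⊥-elim (<⇒≱ (*-pos 0<x+y (x<y⇒0<y-x y<x))
      (≤-via (solve 2 (λ x y → :0 :- (x :+ y) :* (x :- y) := y :* y :- x :* x) refl x y) x²≤y²))
    where
    y<x = ≰⇒> x≰y
    0<x+y = +-pos-nonNegative (≤-<-trans 0≤y y<x) 0≤y

  square-zero : ∀ {x} → x * x ≤ 0# → x ≈ 0#
  square-zero {x} x²≤0 = antisym (square-cancel-≤ ≤-refl (≤-trans x²≤0 0≤0*0))
    (≤-via (solve 1 (λ x → x :- :0 := :0 :- :- x) refl x) (square-cancel-≤ ≤-refl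
      (≤-trans (≤-reflexive (solve 1 (λ x → :- x :* :- x := x :* x) refl x)) (≤-trans x²≤0 0≤0*0))))
    where 0≤0*0 = ≤-reflexive (sym (zeroˡ 0#))

  square-< : ∀ {x y} → y * y < x * x → (y ≤ x) ⊎ (y ≤ - x)
  square-< {x} {y} y²<x² with total 0# x
  ... | inj₁ 0≤x = inj₁ (square-cancel-≤ 0≤x (proj₁ y²<x²))
  ... | inj₂ x≤0 = inj₂ (square-cancel-≤ (≤-resp -0≈0 refl (-‿mono-≤ x≤0))
    (≤-trans (proj₁ y²<x²) (≤-reflexive (solve 1 (λ x → x :* x := :- x :* :- x) refl x))))

  fromℕ-nonNegative : ∀ n → 0# ≤ fromℕ n
  fromℕ-nonNegative zero    = ≤-refl
  fromℕ-nonNegative (suc n) = +-nonNegative 0≤1 (fromℕ-nonNegative n)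

  fromℕ-pos : ∀ n → .{{NonZero n}} → 0# < fromℕ n
  fromℕ-pos (suc n) = +-pos-nonNegative 0<1 (fromℕ-nonNegative n)

  fromℕ-+ : ∀ m n → fromℕ (m ℕ.+ n) ≈ fromℕ m + fromℕ n
  fromℕ-+ = Mult.×-homo-+ 1#

  fromℕ-* : ∀ m n → fromℕ (m ℕ.* n) ≈ fromℕ m * fromℕ n
  fromℕ-* = SMult.×1-homo-*

  0<2 : 0# < fromℕ 2
  0<2 = fromℕ-pos 2

  ½ : R
  ½ = fromℕ 2 ⁻¹

  ½+½≈1 : ½ + ½ ≈ 1#
  ½+½≈1 = trans (solve 1 (λ h → h :+ h := :2 :* h) refl ½) (⁻¹-inverse 0<2)

  0<½ : 0# < ½
  0<½ = ⁻¹-pos 0<2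

  halves : ∀ x → ½ * x + ½ * x ≈ x
  halves x = trans (sym (distribʳ x ½ ½)) (trans (*-congʳ ½+½≈1) (*-identityˡ x))

  ⟶-unique-≤ : ∀ {a l l′} → a ⟶ l → a ⟶ l′ → l ≤ l′
  ⟶-unique-≤ {a} {l} {l′} a⟶l a⟶l′ = ≤-stable λ l≰l′ →
    let ε = ½ * (l - l′)
        0<ε = *-pos 0<½ (x<y⇒0<y-x (≰⇒> l≰l′))
        N , near = a⟶l ε 0<ε
        N′ , near′ = a⟶l′ ε 0<ε
        m = N ℕ.⊔ N′
        below = proj₁ (near m (ℕ.m≤m⊔n N N′))
        above = proj₂ (near′ m (ℕ.m≤n⊔m N N′))
    in <⇒≱ above (≤-via
         (trans (solve 4 (λ a l l′ e → a :- l′ :- e := a :- l :- :- e :+ ((l :- l′) :- (e :+ e))) refl (a m) l l′ ε)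
           (trans (+-congˡ (x≈y⇒x-y≈0 (sym (halves (l - l′))))) (+-identityʳ _)))
         (proj₁ below))

  ⟶-unique : ∀ {a l l′} → a ⟶ l → a ⟶ l′ → l ≈ l′
  ⟶-unique a⟶l a⟶l′ = antisym (⟶-unique-≤ a⟶l a⟶l′) (⟶-unique-≤ a⟶l′ a⟶l)

-- Finite sums and products

module Sums (ℝ : Reals) where

  open RealAnalysis ℝ renaming (fromℕ to fromℕᴿ)
  open OrderedField ℝ
  open import Algebra.Properties.Semiring.Sum semiring public
    using (sum-cong-≋; ∑-distrib-+; *-distribˡ-sum; sum-init-last; sum-replicate-zero)
  open import Algebra.Properties.Monoid.Sum *-monoid public
    using () renaming (sum-cong-≋ to prod-cong-≋)

  sum-mono-≤ : ∀ {n} {f g : Vector R n} → (∀ i → f i ≤ g i) → sum f ≤ sum g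
  sum-mono-≤ {zero}  f≤g = ≤-refl
  sum-mono-≤ {suc n} f≤g = +-mono-≤ (f≤g zero) (sum-mono-≤ (f≤g ∘ suc))

  sum-nonNegative : ∀ {n} {f : Vector R n} → (∀ i → 0# ≤ f i) → 0# ≤ sum f
  sum-nonNegative {zero}  0≤f = ≤-refl
  sum-nonNegative {suc n} 0≤f = +-nonNegative (0≤f zero) (sum-nonNegative (0≤f ∘ suc))

  term≤sum : ∀ {n} {f : Vector R n} → (∀ i → 0# ≤ f i) → ∀ i → f i ≤ sum f
  term≤sum 0≤f zero    = x≤x+y (sum-nonNegative (0≤f ∘ suc))
  term≤sum 0≤f (suc i) = ≤-trans (term≤sum (0≤f ∘ suc) i) (x≤y+x (0≤f zero))

  sum-zero : ∀ {n} {f : Vector R n} → (∀ i → f i ≈ 0#) → sum f ≈ 0#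
  sum-zero {n} f≈0 = trans (sum-cong-≋ f≈0) (sum-replicate-zero n)

  sum-const : ∀ n c → sum {n} (λ _ → c) ≈ fromℕᴿ n * c
  sum-const zero    c = sym (zeroˡ c)
  sum-const (suc n) c = trans (+-congˡ (sum-const n c))
    (solve 2 (λ c m → c :+ m :* c := (:1 :+ m) :* c) refl c (fromℕᴿ n))

  prod-nonNegative : ∀ {n} {f : Vector R n} → (∀ i → 0# ≤ f i) → 0# ≤ prod f
  prod-nonNegative {zero}  0≤f = 0≤1
  prod-nonNegative {suc n} 0≤f = *-nonNegative (0≤f zero) (prod-nonNegative (0≤f ∘ suc))

  prod-mono-≤ : ∀ {n} {f g : Vector R n} → (∀ i → 0# ≤ f i) → (∀ i → f i ≤ g i) → prod f ≤ prod g
  prod-mono-≤ {zero}  0≤f f≤g = ≤-refl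
  prod-mono-≤ {suc n} 0≤f f≤g = *-mono-≤ (≤-trans (0≤f zero) (f≤g zero)) (prod-nonNegative (0≤f ∘ suc))
    (f≤g zero) (prod-mono-≤ (0≤f ∘ suc) (f≤g ∘ suc))

  prod-distrib-* : ∀ {n} (f g : Vector R n) → prod (λ i → f i * g i) ≈ prod f * prod g
  prod-distrib-* {zero}  f g = sym (*-identityˡ 1#)
  prod-distrib-* {suc n} f g = trans (*-congˡ (prod-distrib-* (f ∘ suc) (g ∘ suc)))
    (solve 4 (λ a b c d → a :* b :* (c :* d) := a :* c :* (b :* d)) refl _ _ _ _)

  -- Made for conditioning on one sign: the distinguished coordinate `i` contributes its probability
  -- `c` as an extra factor.
  prod-scale-≤ : ∀ {n} {f g : Vector R n} {c} (i : Fin n) → 0# ≤ c →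
    (∀ j → 0# ≤ f j) → (∀ j → 0# ≤ g j) →
    f i ≤ c * g i → (∀ j → j ≢ i → f j ≤ g j) → prod f ≤ c * prod g
  prod-scale-≤ {suc n} {f} {g} {c} zero 0≤c 0≤f 0≤g fᵢ≤ f≤g = ≤-trans
    (*-mono-≤ (*-nonNegative 0≤c (0≤g zero)) (prod-nonNegative (0≤f ∘ suc)) fᵢ≤
      (prod-mono-≤ (0≤f ∘ suc) λ j → f≤g (suc j) λ ()))
    (≤-reflexive (*-assoc c _ _))
  prod-scale-≤ {suc n} {f} {g} {c} (suc i) 0≤c 0≤f 0≤g fᵢ≤ f≤g = ≤-trans
    (*-mono-≤ (0≤g zero) (prod-nonNegative (0≤f ∘ suc)) (f≤g zero λ ())
      (prod-scale-≤ i 0≤c (0≤f ∘ suc) (0≤g ∘ suc) fᵢ≤ λ j j≢i → f≤g (suc j) (j≢i ∘ Fin.suc-injective)))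
    (≤-reflexive (solve 3 (λ a b c → a :* (c :* b) := c :* (a :* b)) refl _ _ c))

  -- Grows at the end, as partial sums of a series do, whereas `∑` over `Fin` recurses at the front.
  Σ< : (ℕ → R) → ℕ → R
  Σ< f zero    = 0#
  Σ< f (suc m) = Σ< f m + f m

  ∑≈Σ< : ∀ (f : ℕ → R) m → ∑[ k < m ] f (toℕ k) ≈ Σ< f m
  ∑≈Σ< f zero    = refl
  ∑≈Σ< f (suc m) = trans (sum-init-last (f ∘ toℕ {suc m}))
    (+-cong (trans (sum-cong-≋ {m} λ i → reflexive (≡.cong f (Fin.toℕ-inject₁ i))) (∑≈Σ< f m))
            (reflexive (≡.cong f (Fin.toℕ-fromℕ m))))

  Σ<-cong : ∀ {f g} m → (∀ j → j ℕ.< m → f j ≈ g j) → Σ< f m ≈ Σ< g m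
  Σ<-cong zero    f≈g = refl
  Σ<-cong (suc m) f≈g = +-cong (Σ<-cong m λ j j<m → f≈g j (ℕ.m<n⇒m<1+n j<m)) (f≈g m ℕ.≤-refl)

  Σ<-mono-≤ : ∀ {f g} m → (∀ j → j ℕ.< m → f j ≤ g j) → Σ< f m ≤ Σ< g m
  Σ<-mono-≤ zero    f≤g = ≤-refl
  Σ<-mono-≤ (suc m) f≤g = +-mono-≤ (Σ<-mono-≤ m λ j j<m → f≤g j (ℕ.m<n⇒m<1+n j<m)) (f≤g m ℕ.≤-refl)

  Σ<-distrib-+ : ∀ f g m → Σ< (λ j → f j + g j) m ≈ Σ< f m + Σ< g m
  Σ<-distrib-+ f g zero    = sym (+-identityˡ 0#)
  Σ<-distrib-+ f g (suc m) = trans (+-congʳ (Σ<-distrib-+ f g m))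
    (solve 4 (λ a b c d → a :+ b :+ (c :+ d) := a :+ c :+ (b :+ d)) refl _ _ _ _)

  *-distribˡ-Σ< : ∀ c f m → c * Σ< f m ≈ Σ< (λ j → c * f j) m
  *-distribˡ-Σ< c f zero    = zeroʳ c
  *-distribˡ-Σ< c f (suc m) = trans (distribˡ c _ _) (+-congʳ (*-distribˡ-Σ< c f m))

  Σ<-suc : ∀ f m → Σ< f (suc m) ≈ f 0 + Σ< (f ∘ suc) m
  Σ<-suc f zero    = +-comm _ _
  Σ<-suc f (suc m) = trans (+-congʳ (Σ<-suc f m)) (+-assoc _ _ _)

  Σ<-mono-length : ∀ {f m n} → (∀ j → 0# ≤ f j) → m ℕ.≤ n → Σ< f m ≤ Σ< f n
  Σ<-mono-length {f} {m} 0≤f m≤n = go (ℕ.≤⇒≤′ m≤n)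
    where
    go : ∀ {n} → m ℕ.≤′ n → Σ< f m ≤ Σ< f n
    go ℕ.≤′-refl       = ≤-refl
    go (ℕ.≤′-step m≤n) = ≤-trans (go m≤n) (x≤x+y (0≤f _))

  Σ<-nonNegative : ∀ {f} m → (∀ j → 0# ≤ f j) → 0# ≤ Σ< f m
  Σ<-nonNegative m 0≤f = Σ<-mono-length {m = 0} {m} 0≤f ℕ.z≤n

-- Square roots as suprema

module SquareRoot (ℝ : Reals) where

  open RealAnalysis ℝ
  open OrderedField ℝ
  open ≤-Reasoning

  module _ {x : R} (0≤x : 0# ≤ x) where
    private
      P : Pred R 0ℓ
      P y = y * y ≤ x

      r = sqrt x

      inhabited : ∃ P
      inhabited = 0# , ≤-trans (≤-reflexive (zeroˡ 0#)) 0≤x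

      bounded : ∃ (UpperBound P)
      bounded = 1# + x , λ y y²≤x → square-cancel-≤ (+-nonNegative 0≤1 0≤x) (≤-trans y²≤x
        (≤-from-difference (+-nonNegative (+-nonNegative 0≤1 0≤x) (0≤x*x x))
          (solve 1 (λ x → (:1 :+ x) :* (:1 :+ x) := x :+ (:1 :+ x :+ x :* x)) refl x)))

      upper : UpperBound P r
      upper = sup-upper P inhabited bounded

    sqrt-nonNegative : 0# ≤ sqrt x
    sqrt-nonNegative = upper 0# (proj₂ inhabited)

    private
      r²≤x : r * r ≤ x
      r²≤x = ≤-stable λ r²≰x →
        let 0<d : 0# < r * r - x
            0<d = x<y⇒0<y-x (≰⇒> r²≰x)
            0<r : 0# < r
            0<r = ≰⇒> λ r≤0 → r²≰x (≤-trans (≤-resp refl (zeroʳ r) (*-monoˡ-≤ sqrt-nonNegative r≤0)) 0≤x)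
            -- A Newton step: `(r - η)² = x + η²`, so `r - η` is still an upper bound, and smaller
            -- than the supremum `r`.
            η = ½ * (r * r - x) * r ⁻¹
            0<η : 0# < η
            0<η = *-pos (*-pos 0<½ 0<d) (⁻¹-pos 0<r)
            rη≈ : r * η ≈ ½ * (r * r - x)
            rη≈ = trans (solve 3 (λ r h i → r :* (h :* i) := h :* (r :* i)) refl r (½ * (r * r - x)) (r ⁻¹))
              (trans (*-congˡ (⁻¹-inverse 0<r)) (*-identityʳ _))
            r*[r-η]≈ : r * (r - η) ≈ x + ½ * (r * r - x)
            r*[r-η]≈ = trans (solve 2 (λ r n → r :* (r :- n) := r :* r :- r :* n) refl r η)
              (trans (+-cong (trans (solve 2 (λ s x → s := x :+ (s :- x)) refl (r * r) x) (+-congˡ (sym (halves (r * r - x))))) (-‿cong rη≈))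
                (solve 2 (λ x h → x :+ (h :+ h) :- h := x :+ h) refl x (½ * (r * r - x))))
            0≤r-η : 0# ≤ r - η
            0≤r-η = *-cancelˡ-≤ 0<r (≤-trans (≤-reflexive (zeroʳ r))
              (≤-trans (+-nonNegative 0≤x (*-nonNegative (proj₁ 0<½) (proj₁ 0<d))) (≤-reflexive (sym r*[r-η]≈))))
            square : (r - η) * (r - η) ≈ x + η * η
            square = begin-equality
              (r - η) * (r - η)                    ≈⟨ solve 2 (λ r n → (r :- n) :* (r :- n) := r :* (r :- n) :- r :* n :+ n :* n) refl r η ⟩
              r * (r - η) - r * η + η * η          ≈⟨ +-congʳ (+-cong r*[r-η]≈ (-‿cong rη≈)) ⟩
              x + h - h + η * η                    ≈⟨ solve 3 (λ x h n → x :+ h :- h :+ n := x :+ n) refl x h (η * η) ⟩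
              x + η * η                            ∎
            r≤r-η : r ≤ r - η
            r≤r-η = sup-least P inhabited bounded (r - η) λ y y²≤x → square-cancel-≤ 0≤r-η
              (≤-trans y²≤x (≤-trans (x≤x+y (0≤x*x η)) (≤-reflexive (sym square))))
        in <⇒≱ 0<η (≤-via (solve 2 (λ r n → :0 :- n := r :- n :- r) refl r η) r≤r-η)
        where h = ½ * (r * r - x)

      x≤r² : x ≤ r * r
      x≤r² = ≤-stable λ x≰r² →
        let d = x - r * r
            0<d : 0# < d
            0<d = x<y⇒0<y-x (≰⇒> x≰r²)
            -- With `η = d / K` one has `η ≤ 1`, hence `η (η + 2 r) ≤ η K = d`, and `r + η` would
            -- still belong to the set.
            K = 1# + (r + r + d)
            0<K : 0# < K
            0<K = +-pos-nonNegative 0<1 (+-nonNegative (+-nonNegative sqrt-nonNegative sqrt-nonNegative) (proj₁ 0<d))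
            η = d * K ⁻¹
            0<η : 0# < η
            0<η = *-pos 0<d (⁻¹-pos 0<K)
            Kη≈d : K * η ≈ d
            Kη≈d = trans (solve 3 (λ k d i → k :* (d :* i) := d :* (k :* i)) refl K d (K ⁻¹))
              (trans (*-congˡ (⁻¹-inverse 0<K)) (*-identityʳ d))
            η≤1 : η ≤ 1#
            η≤1 = *-cancelˡ-≤ 0<K (≤-resp (sym Kη≈d) (sym (*-identityʳ K))
              (≤-from-difference (+-nonNegative 0≤1 (+-nonNegative sqrt-nonNegative sqrt-nonNegative))
                (solve 2 (λ r d → :1 :+ (r :+ r :+ d) := d :+ (:1 :+ (r :+ r))) refl r d)))
            [r+η]²≤x : (r + η) * (r + η) ≤ x
            [r+η]²≤x = begin
              (r + η) * (r + η)                   ≈⟨ solve 2 (λ r n → (r :+ n) :* (r :+ n) := r :* r :+ n :* (n :+ (r :+ r))) refl r η ⟩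
              r * r + η * (η + (r + r))           ≤⟨ +-monoʳ-≤ (r * r) (*-monoˡ-≤ (proj₁ 0<η) (≤-trans (+-monoˡ-≤ (r + r) η≤1)
                                                       (≤-from-difference (proj₁ 0<d) (solve 2 (λ r d → :1 :+ (r :+ r :+ d) := :1 :+ (r :+ r) :+ d) refl r d)))) ⟩
              r * r + η * K                       ≈⟨ +-congˡ (trans (*-comm η K) Kη≈d) ⟩
              r * r + d                           ≈⟨ solve 2 (λ s x → s :+ (x :- s) := x) refl (r * r) x ⟩
              x                                   ∎
        in <⇒≱ 0<η (≤-via (solve 2 (λ r n → :0 :- n := r :- (r :+ n)) refl r η) (upper (r + η) [r+η]²≤x))

    sqrt-*-sqrt : sqrt x * sqrt x ≈ x
    sqrt-*-sqrt = antisym r²≤x x≤r²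

-- The exponential series, its functional equation, and the logarithm

module Exponential (ℝ : Reals) (markov : MarkovPrinciple) where

  open RealAnalysis ℝ
  open OrderedField ℝ
  open Sums ℝ
  open import Algebra.Properties.Semiring.Exp semiring using (^-congˡ)
  open ≤-Reasoning

  -- If the naturals had a supremum `s`, then `s - 1#` would bound them too. This only refutes the
  -- absence of a witness; `markov` produces one.
  archimedean : ∀ x → ∃ λ n → x ≤ fromℕ n
  archimedean x = markov _ (λ n → x ≤? fromℕ n) λ none →
    let bounded : UpperBound IsNatural x
        bounded = λ { _ (n , ≡.refl) → ≰⇒≥ λ x≤n → none (n , x≤n) }
        s = sup IsNatural
        upper = sup-upper IsNatural inhabited (x , bounded)
        least : s ≤ s - 1#
        least = sup-least IsNatural inhabited (x , bounded) (s - 1#) λ { _ (n , ≡.refl) →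
          ≤-via (solve 2 (λ s n → s :- :1 :- n := s :- (:1 :+ n)) refl s (fromℕ n))
                (upper (fromℕ (suc n)) (suc n , ≡.refl)) }
    in <⇒≱ 0<1 (≤-via (solve 1 (λ s → :0 :- :1 := s :- :1 :- s) refl s) least)
    where
    IsNatural : Pred R 0ℓ
    IsNatural y = ∃ λ n → y ≡ fromℕ n
    inhabited : ∃ IsNatural
    inhabited = 0# , 0 , ≡.refl

  term : R → ℕ → R
  term x k = x ^ k / fromℕ (k !)

  private
    0<k! : ∀ k → 0# < fromℕ (k !)
    0<k! k = fromℕ-pos (k !) {{k ℕ.!≢0}}

  term-zero : ∀ x → term x 0 ≈ 1#
  term-zero x = trans (*-congʳ (sym (+-identityʳ 1#))) (⁻¹-inverse (0<k! 0))

  term-suc : ∀ x k → fromℕ (suc k) * term x (suc k) ≈ x * term x k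
  term-suc x k = *-cancelˡ (0<k! k) (begin-equality
    b * (a * (x * x ^ k * i))  ≈⟨ solve 5 (λ b a x p i → b :* (a :* (x :* p :* i)) := x :* p :* (a :* b :* i)) refl b a x (x ^ k) i ⟩
    x * x ^ k * (a * b * i)    ≈⟨ *-congˡ (trans (*-congʳ (sym (fromℕ-* (suc k) (k !)))) (⁻¹-inverse (0<k! (suc k)))) ⟩
    x * x ^ k * 1#             ≈⟨ *-congˡ (⁻¹-inverse (0<k! k)) ⟨
    x * x ^ k * (b * j)        ≈⟨ solve 4 (λ b x p j → x :* p :* (b :* j) := b :* (x :* (p :* j))) refl b x (x ^ k) j ⟩
    b * (x * (x ^ k * j))      ∎)
    where
    a = fromℕ (suc k)
    b = fromℕ (k !)
    i = fromℕ (suc k !) ⁻¹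
    j = b ⁻¹

  ^-nonNegative : ∀ {x} k → 0# ≤ x → 0# ≤ x ^ k
  ^-nonNegative zero    0≤x = 0≤1
  ^-nonNegative (suc k) 0≤x = *-nonNegative 0≤x (^-nonNegative k 0≤x)

  term-nonNegative : ∀ {x} → 0# ≤ x → ∀ k → 0# ≤ term x k
  term-nonNegative 0≤x k = *-nonNegative (^-nonNegative k 0≤x) (proj₁ (⁻¹-pos (0<k! k)))

  E : R → ℕ → R
  E x = Σ< (term x)

  E-cong : ∀ {x y} → x ≈ y → ∀ m → E x m ≈ E y m
  E-cong x≈y m = Σ<-cong m λ k _ → *-congʳ (^-congˡ k x≈y)

  E-mono-length : ∀ {x m n} → 0# ≤ x → m ℕ.≤ n → E x m ≤ E x n
  E-mono-length 0≤x = Σ<-mono-length (term-nonNegative 0≤x)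

  module Binomial (x y : R) where
    t = term x
    u = term y

    convolution : ℕ → R
    convolution m = Σ< (λ j → t j * u (m ∸ j)) (suc m)

    -- Replaces the binomial theorem. Writing `m + 1 = j + (m + 1 - j)`, the recurrence `term-suc`
    -- lowers the index of one factor in each part, so the convolution obeys the recurrence that
    -- characterises `term (x + y)`.
    convolution-suc : ∀ m → fromℕ (suc m) * convolution (suc m) ≈ (x + y) * convolution m
    convolution-suc m = begin-equality
      fromℕ (suc m) * convolution (suc m)
        ≈⟨ *-distribˡ-Σ< (fromℕ (suc m)) (λ j → t j * u (suc m ∸ j)) (2 ℕ.+ m) ⟩
      Σ< (λ j → fromℕ (suc m) * (t j * u (suc m ∸ j))) (2 ℕ.+ m)
        ≈⟨ Σ<-cong (2 ℕ.+ m) (λ j j<2+m → split j (ℕ.≤-pred j<2+m)) ⟩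
      Σ< (λ j → left j + right j) (2 ℕ.+ m)
        ≈⟨ Σ<-distrib-+ left right (2 ℕ.+ m) ⟩
      Σ< left (2 ℕ.+ m) + Σ< right (2 ℕ.+ m)
        ≈⟨ +-cong Σleft Σright ⟩
      x * convolution m + y * convolution m
        ≈⟨ distribʳ (convolution m) x y ⟨
      (x + y) * convolution m ∎
      where
      left right : ℕ → R
      left j = fromℕ j * t j * u (suc m ∸ j)
      right j = t j * (fromℕ (suc m ∸ j) * u (suc m ∸ j))

      split : ∀ j → j ℕ.≤ suc m → fromℕ (suc m) * (t j * u (suc m ∸ j)) ≈ left j + right j
      split j j≤1+m = trans
        (*-congʳ (trans (reflexive (≡.cong fromℕ (≡.sym (ℕ.m+[n∸m]≡n j≤1+m)))) (fromℕ-+ j (suc m ∸ j))))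
        (solve 4 (λ a b c d → (a :+ b) :* (c :* d) := a :* c :* d :+ c :* (b :* d)) refl _ _ _ _)

      Σleft : Σ< left (2 ℕ.+ m) ≈ x * convolution m
      Σleft = trans (Σ<-suc left (suc m)) (trans
        (trans (+-congʳ (trans (*-congʳ (zeroˡ _)) (zeroˡ _))) (+-identityˡ _))
        (trans (Σ<-cong (suc m) λ j _ → trans (*-congʳ (term-suc x j)) (*-assoc _ _ _))
          (sym (*-distribˡ-Σ< x (λ j → t j * u (m ∸ j)) (suc m)))))

      Σright : Σ< right (2 ℕ.+ m) ≈ y * convolution m
      Σright = trans (+-congˡ last≈0) (trans (+-identityʳ _)
        (trans (Σ<-cong (suc m) step) (sym (*-distribˡ-Σ< y (λ j → t j * u (m ∸ j)) (suc m)))))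
        where
        last≈0 : right (suc m) ≈ 0#
        last≈0 rewrite ℕ.n∸n≡0 m = trans (*-congˡ (zeroˡ _)) (zeroʳ _)
        step : ∀ j → j ℕ.< suc m → right j ≈ y * (t j * u (m ∸ j))
        step j j<1+m rewrite ℕ.+-∸-assoc 1 (ℕ.≤-pred j<1+m) = trans (*-congˡ (term-suc y (m ∸ j)))
          (solve 3 (λ a b c → a :* (b :* c) := b :* (a :* c)) refl _ _ _)

    term-+ : ∀ m → term (x + y) m ≈ convolution m
    term-+ zero = trans (term-zero (x + y)) (sym (trans (+-identityˡ _)
      (trans (*-cong (term-zero x) (term-zero y)) (*-identityˡ 1#))))
    term-+ (suc m) = *-cancelˡ (fromℕ-pos (suc m))
      (trans (term-suc (x + y) m) (trans (*-congˡ (term-+ m)) (sym (convolution-suc m))))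

    -- The products `t j * u k` over the triangle `j + k < m`, collected by rows. The row `j = m` is
    -- empty, so it can be added before the next antidiagonal joins.
    E-+ : ∀ m → E (x + y) m ≈ Σ< (λ j → t j * E y (m ∸ j)) m
    E-+ zero    = refl
    E-+ (suc m) = begin-equality
      E (x + y) m + term (x + y) m
        ≈⟨ +-cong (E-+ m) (term-+ m) ⟩
      Σ< (λ j → t j * E y (m ∸ j)) m + convolution m
        ≈⟨ +-congʳ (+-identityʳ _) ⟨
      Σ< (λ j → t j * E y (m ∸ j)) m + 0# + convolution m
        ≈⟨ +-congʳ (+-congˡ last≈0) ⟨
      Σ< (λ j → t j * E y (m ∸ j)) (suc m) + convolution m
        ≈⟨ Σ<-distrib-+ _ _ (suc m) ⟨
      Σ< (λ j → t j * E y (m ∸ j) + t j * u (m ∸ j)) (suc m)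
        ≈⟨ Σ<-cong (suc m) (λ j j<1+m → trans (sym (distribˡ _ _ _))
             (*-congˡ (reflexive (≡.cong (E y) (≡.sym (ℕ.+-∸-assoc 1 (ℕ.≤-pred j<1+m))))))) ⟩
      Σ< (λ j → t j * E y (suc m ∸ j)) (suc m) ∎
      where
      last≈0 : t m * E y (m ∸ m) ≈ 0#
      last≈0 rewrite ℕ.n∸n≡0 m = zeroʳ _

  module _ {x y : R} (0≤x : 0# ≤ x) (0≤y : 0# ≤ y) where
    open Binomial x y

    -- The triangle `j + k < m` lies inside the square of side `m`, and all terms are nonnegative.
    E-+-≤ : ∀ m → E (x + y) m ≤ E x m * E y m
    E-+-≤ m = begin
      E (x + y) m                        ≈⟨ E-+ m ⟩
      Σ< (λ j → t j * E y (m ∸ j)) m     ≤⟨ Σ<-mono-≤ m (λ j _ → *-monoˡ-≤ (term-nonNegative 0≤x j) (E-mono-length 0≤y (ℕ.m∸n≤m m j))) ⟩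
      Σ< (λ j → t j * E y m) m           ≈⟨ Σ<-cong m (λ _ _ → *-comm _ _) ⟩
      Σ< (λ j → E y m * t j) m           ≈⟨ *-distribˡ-Σ< (E y m) t m ⟨
      E y m * E x m                      ≈⟨ *-comm _ _ ⟩
      E x m * E y m                      ∎

    -- The `m` by `n` rectangle lies inside the triangle `j + k < m + n`.
    E-*-≤ : ∀ m n → E x m * E y n ≤ E (x + y) (m ℕ.+ n)
    E-*-≤ m n = begin
      E x m * E y n                                   ≈⟨ *-comm _ _ ⟩
      E y n * E x m                                   ≈⟨ *-distribˡ-Σ< (E y n) t m ⟩
      Σ< (λ j → E y n * t j) m                        ≈⟨ Σ<-cong m (λ _ _ → *-comm _ _) ⟩
      Σ< (λ j → t j * E y n) m                        ≤⟨ Σ<-mono-≤ m (λ j j<m → *-monoˡ-≤ (term-nonNegative 0≤x j) (E-mono-length 0≤y (n≤ j<m))) ⟩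
      Σ< (λ j → t j * E y (m ℕ.+ n ∸ j)) m            ≤⟨ Σ<-mono-length (λ j → *-nonNegative (term-nonNegative 0≤x j) (E-nonNegative (m ℕ.+ n ∸ j))) (ℕ.m≤m+n m n) ⟩
      Σ< (λ j → t j * E y (m ℕ.+ n ∸ j)) (m ℕ.+ n)    ≈⟨ E-+ (m ℕ.+ n) ⟨
      E (x + y) (m ℕ.+ n)                             ∎
      where
      E-nonNegative : ∀ k → 0# ≤ E y k
      E-nonNegative k = Σ<-nonNegative k (term-nonNegative 0≤y)
      n≤ : ∀ {j} → j ℕ.< m → n ℕ.≤ m ℕ.+ n ∸ j
      n≤ {j} j<m = ℕ.m+n≤o⇒m≤o∸n n (ℕ.≤-trans (ℕ.≤-reflexive (ℕ.+-comm n j)) (ℕ.+-monoˡ-≤ n (ℕ.<⇒≤ j<m)))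

  1≤k! : ∀ k → 1# ≤ fromℕ (k !)
  1≤k! k with k ! | ℕ.n≢0⇒n>0 (ℕ.≢-nonZero⁻¹ (k !) {{k ℕ.!≢0}})
  ... | suc n | _ = x≤x+y (fromℕ-nonNegative n)

  term≤^ : ∀ {u} → 0# ≤ u → ∀ k → term u k ≤ u ^ k
  term≤^ {u} 0≤u k = begin
    u ^ k * i                  ≤⟨ *-monoˡ-≤ (^-nonNegative k 0≤u) i≤1 ⟩
    u ^ k * 1#                 ≈⟨ *-identityʳ _ ⟩
    u ^ k                      ∎
    where
    i = fromℕ (k !) ⁻¹
    i≤1 : i ≤ 1#
    i≤1 = ≤-resp (*-identityˡ i) (⁻¹-inverse (0<k! k)) (*-monoʳ-≤ (proj₁ (⁻¹-pos (0<k! k))) (1≤k! k))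

  -- Factorials are at least 1, so powers of `u` dominate the terms and the geometric sum
  -- telescopes; multiplying by `1# - u` keeps the induction free of division.
  E-geometric : ∀ {u} → 0# ≤ u → u ≤ 1# → ∀ m → E u m * (1# - u) ≤ 1# - u ^ m
  E-geometric {u} 0≤u u≤1 zero = ≤-reflexive (trans (zeroˡ _) (sym (-‿inverseʳ 1#)))
  E-geometric {u} 0≤u u≤1 (suc m) = begin
    (E u m + term u m) * (1# - u)                ≈⟨ distribʳ _ _ _ ⟩
    E u m * (1# - u) + term u m * (1# - u)       ≤⟨ +-mono-≤ (E-geometric 0≤u u≤1 m) (*-monoʳ-≤ (x≤y⇒0≤y-x u≤1) (term≤^ 0≤u m)) ⟩
    (1# - u ^ m) + u ^ m * (1# - u)              ≈⟨ solve 2 (λ u p → :1 :- p :+ p :* (:1 :- u) := :1 :- u :* p) refl u (u ^ m) ⟩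
    1# - u ^ suc m                               ∎

  E-*-1-u≤1 : ∀ {u} → 0# ≤ u → u ≤ 1# → ∀ m → (1# - u) * E u m ≤ 1#
  E-*-1-u≤1 {u} 0≤u u≤1 m = begin
    (1# - u) * E u m   ≈⟨ *-comm _ _ ⟩
    E u m * (1# - u)   ≤⟨ E-geometric 0≤u u≤1 m ⟩
    1# - u ^ m         ≤⟨ ≤-via (solve 1 (λ p → :1 :- (:1 :- p) := p :- :0) refl (u ^ m)) (^-nonNegative m 0≤u) ⟩
    1#                 ∎

  E-nonNegative : ∀ {x} → 0# ≤ x → ∀ m → 0# ≤ E x m
  E-nonNegative 0≤x m = Σ<-nonNegative m (term-nonNegative 0≤x)

  E-fromℕ-* : ∀ {u b} → 0# ≤ u → 0# ≤ b → ∀ m → E u m ≤ b → ∀ n → E (fromℕ (suc n) * u) m ≤ b ^ suc n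
  E-fromℕ-* {u} {b} 0≤u 0≤b m E≤b zero = ≤-trans
    (≤-reflexive (E-cong (trans (*-congʳ (+-identityʳ 1#)) (*-identityˡ u)) m))
    (≤-trans E≤b (≤-reflexive (sym (*-identityʳ b))))
  E-fromℕ-* {u} {b} 0≤u 0≤b m E≤b (suc n) = begin
    E ((1# + fromℕ (suc n)) * u) m    ≈⟨ E-cong (trans (distribʳ _ _ _) (+-congʳ (*-identityˡ u))) m ⟩
    E (u + fromℕ (suc n) * u) m       ≤⟨ E-+-≤ 0≤u 0≤nu m ⟩
    E u m * E (fromℕ (suc n) * u) m   ≤⟨ *-mono-≤ 0≤b (E-nonNegative 0≤nu m) E≤b (E-fromℕ-* 0≤u 0≤b m E≤b n) ⟩
    b * b ^ suc n                     ∎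
    where 0≤nu = *-nonNegative (fromℕ-nonNegative (suc n)) 0≤u

  -- The geometric comparison needs an argument below 1. Dividing `x` by a natural number `N > x`
  -- provides one, and submultiplicativity of the partial sums raises its bound to the power `N`.
  E-bounded : ∀ {x} → 0# ≤ x → ∃ λ b → ∀ m → E x m ≤ b
  E-bounded {x} 0≤x = b ^ suc n , λ m → ≤-trans (≤-reflexive (E-cong x≈Nu m)) (E-fromℕ-* 0≤u 0≤b m (E≤b m) n)
    where
    n = proj₁ (archimedean x)
    N = fromℕ (suc n)
    0<N = fromℕ-pos (suc n)
    u = x * N ⁻¹
    b = (1# - u) ⁻¹
    x≈Nu : x ≈ N * u
    x≈Nu = sym (trans (solve 3 (λ n x i → n :* (x :* i) := x :* (n :* i)) refl N x (N ⁻¹))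
      (trans (*-congˡ (⁻¹-inverse 0<N)) (*-identityʳ x)))
    0≤u = *-nonNegative 0≤x (proj₁ (⁻¹-pos 0<N))
    u<1 : u < 1#
    u<1 = ≰⇒> λ 1≤u → <⇒≱
      (≤-<-trans (proj₂ (archimedean x)) (<-via (solve 1 (λ n → :1 :+ n :- n := :1 :- :0) refl (fromℕ n)) 0<1))
      (≤-resp (*-identityʳ N) (sym x≈Nu) (*-monoˡ-≤ (proj₁ 0<N) 1≤u))
    0<1-u = x<y⇒0<y-x u<1
    0≤b = proj₁ (⁻¹-pos 0<1-u)
    E≤b : ∀ m → E u m ≤ b
    E≤b m = *-cancelˡ-≤ 0<1-u (≤-trans (E-*-1-u≤1 0≤u (proj₁ u<1) m) (≤-reflexive (sym (⁻¹-inverse 0<1-u))))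

  IsPartialSum : R → Pred R 0ℓ
  IsPartialSum x y = ∃ λ m → y ≡ E x m

  -- For nonnegative arguments the partial sums increase, and their supremum is easier to estimate
  -- than the limit that defines `exp`; `exp≈Exp` identifies the two.
  Exp : R → R
  Exp x = sup (IsPartialSum x)

  private
    partialSums-inhabited : ∀ x → ∃ (IsPartialSum x)
    partialSums-inhabited x = 0# , 0 , ≡.refl

    partialSums-bounded : ∀ {x} → 0# ≤ x → ∃ (UpperBound (IsPartialSum x))
    partialSums-bounded 0≤x = let b , E≤b = E-bounded 0≤x in b , λ { _ (m , ≡.refl) → E≤b m }

  E≤Exp : ∀ {x} → 0# ≤ x → ∀ m → E x m ≤ Exp x
  E≤Exp {x} 0≤x m = sup-upper (IsPartialSum x) (partialSums-inhabited x) (partialSums-bounded 0≤x) _ (m , ≡.refl)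

  Exp-least : ∀ {x b} → 0# ≤ x → (∀ m → E x m ≤ b) → Exp x ≤ b
  Exp-least {x} 0≤x E≤b = sup-least (IsPartialSum x) (partialSums-inhabited x) (partialSums-bounded 0≤x) _
    λ { _ (m , ≡.refl) → E≤b m }

  Exp-cong-≤ : ∀ {x y} → 0# ≤ x → x ≈ y → Exp x ≤ Exp y
  Exp-cong-≤ 0≤x x≈y = Exp-least 0≤x λ m → ≤-trans (≤-reflexive (E-cong x≈y m))
    (E≤Exp (≤-trans 0≤x (≤-reflexive x≈y)) m)

  Exp-cong : ∀ {x y} → 0# ≤ x → x ≈ y → Exp x ≈ Exp y
  Exp-cong 0≤x x≈y = antisym (Exp-cong-≤ 0≤x x≈y) (Exp-cong-≤ (≤-trans 0≤x (≤-reflexive x≈y)) (sym x≈y))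

  1+x≤Exp : ∀ {x} → 0# ≤ x → 1# + x ≤ Exp x
  1+x≤Exp {x} 0≤x = ≤-trans (≤-reflexive (sym E₂)) (E≤Exp 0≤x 2)
    where
    term₁ : term x 1 ≈ x
    term₁ = trans (sym (trans (*-congʳ (+-identityʳ 1#)) (*-identityˡ _)))
      (trans (term-suc x 0) (trans (*-congˡ (term-zero x)) (*-identityʳ x)))
    E₂ : E x 2 ≈ 1# + x
    E₂ = +-cong (trans (+-identityˡ _) (term-zero x)) term₁

  1≤Exp : ∀ {x} → 0# ≤ x → 1# ≤ Exp x
  1≤Exp 0≤x = ≤-trans (x≤x+y 0≤x) (1+x≤Exp 0≤x)

  0<Exp : ∀ {x} → 0# ≤ x → 0# < Exp x
  0<Exp 0≤x = <-≤-trans 0<1 (1≤Exp 0≤x)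

  [1-u]*Exp≤1 : ∀ {u} → 0# ≤ u → u < 1# → (1# - u) * Exp u ≤ 1#
  [1-u]*Exp≤1 {u} 0≤u u<1 = ≤-trans
    (*-monoˡ-≤ (proj₁ 0<1-u) (Exp-least 0≤u λ m →
      *-cancelˡ-≤ 0<1-u (≤-trans (E-*-1-u≤1 0≤u (proj₁ u<1) m) (≤-reflexive (sym (⁻¹-inverse 0<1-u))))))
    (≤-reflexive (⁻¹-inverse 0<1-u))
    where 0<1-u = x<y⇒0<y-x u<1

  -- For the lower bound the two suprema are taken one at a time, each after dividing by the other,
  -- positive factor.
  Exp-+ : ∀ {x y} → 0# ≤ x → 0# ≤ y → Exp (x + y) ≈ Exp x * Exp y
  Exp-+ {x} {y} 0≤x 0≤y = antisym
    (Exp-least 0≤x+y λ m → ≤-trans (E-+-≤ 0≤x 0≤y m)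
      (*-mono-≤ (proj₁ (0<Exp 0≤x)) (E-nonNegative 0≤y m) (E≤Exp 0≤x m) (E≤Exp 0≤y m)))
    (begin
      Exp x * Exp y          ≈⟨ *-comm _ _ ⟩
      Exp y * Exp x          ≤⟨ *-monoˡ-≤ (proj₁ (0<Exp 0≤y)) (Exp-least 0≤x λ m → ≤-divide (0<Exp 0≤y) (Exp-y*E≤ m)) ⟩
      Exp y * (Exp y ⁻¹ * Exp (x + y)) ≈⟨ cancel (0<Exp 0≤y) ⟩
      Exp (x + y)            ∎)
    where
    0≤x+y = +-nonNegative 0≤x 0≤y
    cancel : ∀ {c z} → 0# < c → c * (c ⁻¹ * z) ≈ z
    cancel 0<c = trans (sym (*-assoc _ _ _)) (trans (*-congʳ (⁻¹-inverse 0<c)) (*-identityˡ _))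
    ≤-divide : ∀ {c w z} → 0# < c → c * w ≤ z → w ≤ c ⁻¹ * z
    ≤-divide 0<c cw≤z = *-cancelˡ-≤ 0<c (≤-trans cw≤z (≤-reflexive (sym (cancel 0<c))))
    Exp-y*E≤ : ∀ m → Exp y * E x m ≤ Exp (x + y)
    -- The empty partial sum is 0 and cannot be divided by, so it is split off.
    Exp-y*E≤ zero    = ≤-trans (≤-reflexive (zeroʳ _)) (proj₁ (0<Exp 0≤x+y))
    Exp-y*E≤ (suc m) = ≤-trans (≤-reflexive (*-comm _ _)) (≤-trans
      (*-monoˡ-≤ (proj₁ 0<Eₘ) (Exp-least 0≤y λ n →
        ≤-divide 0<Eₘ (≤-trans (E-*-≤ 0≤x 0≤y (suc m) n) (E≤Exp 0≤x+y (suc m ℕ.+ n)))))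
      (≤-reflexive (cancel 0<Eₘ)))
      where
      0<Eₘ : 0# < E x (suc m)
      0<Eₘ = <-≤-trans 0<1 (≤-trans (≤-reflexive (sym (trans (+-identityˡ _) (term-zero x))))
        (E-mono-length {m = 1} {suc m} 0≤x (ℕ.s≤s ℕ.z≤n)))

  Exp-zero : Exp 0# ≈ 1#
  Exp-zero = antisym (≤-trans (≤-reflexive (sym (trans (*-congʳ 1-0≈1) (*-identityˡ _)))) ([1-u]*Exp≤1 ≤-refl 0<1))
    (1≤Exp ≤-refl)
    where
    1-0≈1 : 1# - 0# ≈ 1#
    1-0≈1 = solve 0 (:1 :- :0 := :1) refl

  partialSum : R → ℕ → R
  partialSum x m = ∑[ k < m ] term x (toℕ k)

  -- If every partial sum stayed below `Exp x - ε`, that number would be a smaller upper bound.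
  -- `markov` extracts an index that exceeds it, and monotonicity covers all later ones.
  partialSum⟶Exp : ∀ {x} → 0# ≤ x → partialSum x ⟶ Exp x
  partialSum⟶Exp {x} 0≤x ε 0<ε = N , λ m N≤m →
    let Eₘ≈ = ∑≈Σ< (term x) m in
      <-via (trans (+-congʳ (+-congʳ Eₘ≈)) (solve 3 (λ a b e → a :- b :- :- e := a :- (b :- e)) refl (E x m) (Exp x) ε))
        (<-≤-trans (≰⇒> close) (E-mono-length 0≤x N≤m))
    , ≤-<-trans (≤-via (trans (+-congˡ (-‿cong (+-congʳ Eₘ≈))) (solve 2 (λ a b → :0 :- (a :- b) := b :- a) refl (E x m) (Exp x)))
        (E≤Exp 0≤x m)) 0<ε
    where
    witness : ∃ λ n → ¬ (E x n ≤ Exp x - ε)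
    witness = markov _ (λ n → ¬? (E x n ≤? Exp x - ε)) λ none → <⇒≱ 0<ε
      (≤-via (solve 2 (λ s e → :0 :- e := s :- e :- s) refl (Exp x) ε)
        (Exp-least 0≤x λ n → ≤-stable λ far → none (n , far)))
    N = proj₁ witness
    close = proj₂ witness

  -- `lim` is the supremum of the set of all limits, and by uniqueness `Exp x` is the greatest
  -- element of that set.
  exp≈Exp : ∀ {x} → 0# ≤ x → exp x ≈ Exp x
  exp≈Exp {x} 0≤x = antisym
    (sup-least _ inhabited bounded (Exp x) below)
    (sup-upper _ inhabited bounded (Exp x) (partialSum⟶Exp 0≤x))
    where
    below : UpperBound (partialSum x ⟶_) (Exp x)
    below l a⟶l = ⟶-unique-≤ a⟶l (partialSum⟶Exp 0≤x)
    inhabited : ∃ (partialSum x ⟶_)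
    inhabited = Exp x , partialSum⟶Exp 0≤x
    bounded : ∃ (UpperBound (partialSum x ⟶_))
    bounded = Exp x , below

  -- If `Exp x ≤ y`, then `x` belongs to the set whose supremum is `ln y`. That set contains 0
  -- because `1# ≤ y`, and it is bounded by `y` because `z ≤ exp z` for nonnegative `z`.
  ln<⇒<Exp : ∀ {x y} → 0# ≤ x → 1# ≤ y → ln y < x → y < Exp x
  ln<⇒<Exp {x} {y} 0≤x 1≤y ln<x = ≰⇒> λ Exp≤y → <⇒≱ ln<x
    (sup-upper (λ z → exp z ≤ y) inhabited (y , bounded) x (≤-trans (≤-reflexive (exp≈Exp 0≤x)) Exp≤y))
    where
    inhabited : ∃ λ z → exp z ≤ y
    inhabited = 0# , ≤-trans (≤-reflexive (trans (exp≈Exp ≤-refl) Exp-zero)) 1≤y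
    bounded : UpperBound (λ z → exp z ≤ y) y
    bounded z exp≤y with total 0# z
    ... | inj₁ 0≤z = ≤-trans (≤-trans (x≤y+x 0≤1) (1+x≤Exp 0≤z)) (≤-trans (≤-reflexive (sym (exp≈Exp 0≤z))) exp≤y)
    ... | inj₂ z≤0 = ≤-trans z≤0 (≤-trans 0≤1 1≤y)

  posPart : R → R
  posPart x with 0# ≤? x
  ... | yes _ = x
  ... | no _  = 0#

  posPart-nonNegative : ∀ x → 0# ≤ posPart x
  posPart-nonNegative x with 0# ≤? x
  ... | yes 0≤x = 0≤x
  ... | no _    = ≤-refl

  posPart-nonNeg-≈ : ∀ {x} → 0# ≤ x → posPart x ≈ x
  posPart-nonNeg-≈ {x} 0≤x with 0# ≤? x
  ... | yes _   = refl
  ... | no 0≰x  = ⊥-elim (0≰x 0≤x)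

  posPart-nonPos-≈ : ∀ {x} → x ≤ 0# → posPart x ≈ 0#
  posPart-nonPos-≈ {x} x≤0 with 0# ≤? x
  ... | yes 0≤x = antisym x≤0 0≤x
  ... | no _    = refl

  posPart-difference : ∀ x → x ≈ posPart x - posPart (- x)
  posPart-difference x with total 0# x
  ... | inj₁ 0≤x = sym (trans (+-cong (posPart-nonNeg-≈ 0≤x) (-‿cong (posPart-nonPos-≈ -x≤0)))
        (solve 1 (λ x → x :- :0 := x) refl x))
    where -x≤0 = ≤-via (solve 1 (λ x → :0 :- :- x := x :- :0) refl x) 0≤x
  ... | inj₂ x≤0 = sym (trans (+-cong (posPart-nonPos-≈ x≤0) (-‿cong (posPart-nonNeg-≈ 0≤-x)))
        (solve 1 (λ x → :0 :- :- x := x) refl x))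
    where 0≤-x = ≤-via (solve 1 (λ x → :- x :- :0 := :0 :- x) refl x) x≤0

  -- The exponential on all of R; exp itself is only analysed at nonnegative arguments.
  e : R → R
  e x = Exp (posPart x) * Exp (posPart (- x)) ⁻¹

  -- The value of `e` does not depend on how its argument is written as a difference of nonnegative
  -- numbers; clearing the denominators reduces this to `Exp-+`.
  e-difference : ∀ {x p q} → 0# ≤ p → 0# ≤ q → x ≈ p - q → e x * Exp q ≈ Exp p
  e-difference {x} {p} {q} 0≤p 0≤q x≈p-q = *-cancelˡ 0<Exp⁻ (begin-equality
    E⁻ * (E⁺ * E⁻ ⁻¹ * Exp q)   ≈⟨ solve 4 (λ a b c d → a :* (b :* c :* d) := a :* c :* (b :* d)) refl E⁻ E⁺ (E⁻ ⁻¹) (Exp q) ⟩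
    E⁻ * E⁻ ⁻¹ * (E⁺ * Exp q)   ≈⟨ trans (*-congʳ (⁻¹-inverse 0<Exp⁻)) (*-identityˡ _) ⟩
    E⁺ * Exp q                  ≈⟨ Exp-+ 0≤x⁺ 0≤q ⟨
    Exp (x⁺ + q)                ≈⟨ Exp-cong (+-nonNegative 0≤x⁺ 0≤q) balance ⟩
    Exp (x⁻ + p)                ≈⟨ Exp-+ 0≤x⁻ 0≤p ⟩
    E⁻ * Exp p                  ∎)
    where
    x⁺ = posPart x
    x⁻ = posPart (- x)
    E⁺ = Exp x⁺
    E⁻ = Exp x⁻
    0≤x⁺ = posPart-nonNegative x
    0≤x⁻ = posPart-nonNegative (- x)
    0<Exp⁻ = 0<Exp 0≤x⁻
    balance : x⁺ + q ≈ x⁻ + p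
    balance = begin-equality
      x⁺ + q                  ≈⟨ solve 3 (λ a b q → a :+ q := (a :- b) :+ (b :+ q)) refl x⁺ x⁻ q ⟩
      (x⁺ - x⁻) + (x⁻ + q)    ≈⟨ +-congʳ (trans (sym (posPart-difference x)) x≈p-q) ⟩
      (p - q) + (x⁻ + q)      ≈⟨ solve 3 (λ p q b → (p :- q) :+ (b :+ q) := b :+ p) refl p q x⁻ ⟩
      x⁻ + p                  ∎

  e≈Exp : ∀ {x} → 0# ≤ x → e x ≈ Exp x
  e≈Exp {x} 0≤x = trans (sym (trans (*-congˡ Exp-zero) (*-identityʳ _)))
    (e-difference 0≤x ≤-refl (solve 1 (λ x → x := x :- :0) refl x))

  e-split : ∀ x → e x * Exp (posPart (- x)) ≈ Exp (posPart x)
  e-split x = e-difference (posPart-nonNegative x) (posPart-nonNegative (- x)) (posPart-difference x)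

  0<e : ∀ x → 0# < e x
  0<e x = *-pos (0<Exp (posPart-nonNegative x)) (⁻¹-pos (0<Exp (posPart-nonNegative (- x))))

  0≤e : ∀ x → 0# ≤ e x
  0≤e x = proj₁ (0<e x)

  -- `posPart` branches on a decision, so congruence is not structural; instead `x` is represented
  -- by the positive and negative parts of `y`.
  e-cong : ∀ {x y} → x ≈ y → e x ≈ e y
  e-cong {x} {y} x≈y = *-cancelˡ (0<Exp (posPart-nonNegative (- y))) (trans (*-comm _ _) (trans
    (e-difference (posPart-nonNegative y) (posPart-nonNegative (- y)) (trans x≈y (posPart-difference y)))
    (trans (sym (e-split y)) (*-comm _ _))))

  e-+ : ∀ x y → e (x + y) ≈ e x * e y
  e-+ x y = *-cancelˡ (*-pos (0<Exp 0≤x⁻) (0<Exp 0≤y⁻)) (begin-equality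
    Exp x⁻ * Exp y⁻ * e (x + y)           ≈⟨ *-congʳ (Exp-+ 0≤x⁻ 0≤y⁻) ⟨
    Exp (x⁻ + y⁻) * e (x + y)             ≈⟨ *-comm _ _ ⟩
    e (x + y) * Exp (x⁻ + y⁻)             ≈⟨ e-difference (+-nonNegative 0≤x⁺ 0≤y⁺) (+-nonNegative 0≤x⁻ 0≤y⁻)
                                               (trans (+-cong (posPart-difference x) (posPart-difference y))
                                                 (solve 4 (λ a b c d → a :- b :+ (c :- d) := a :+ c :- (b :+ d)) refl x⁺ x⁻ y⁺ y⁻)) ⟩
    Exp (x⁺ + y⁺)                         ≈⟨ Exp-+ 0≤x⁺ 0≤y⁺ ⟩
    Exp x⁺ * Exp y⁺                       ≈⟨ *-cong (e-split x) (e-split y) ⟨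
    e x * Exp x⁻ * (e y * Exp y⁻)         ≈⟨ solve 4 (λ a b c d → a :* b :* (c :* d) := b :* d :* (a :* c)) refl _ _ _ _ ⟩
    Exp x⁻ * Exp y⁻ * (e x * e y)         ∎)
    where
    x⁺ = posPart x
    x⁻ = posPart (- x)
    y⁺ = posPart y
    y⁻ = posPart (- y)
    0≤x⁺ = posPart-nonNegative x
    0≤x⁻ = posPart-nonNegative (- x)
    0≤y⁺ = posPart-nonNegative y
    0≤y⁻ = posPart-nonNegative (- y)

  e-zero : e 0# ≈ 1#
  e-zero = trans (e≈Exp ≤-refl) Exp-zero

  e-inverse : ∀ x → e x * e (- x) ≈ 1#
  e-inverse x = trans (sym (e-+ x (- x))) (trans (e-cong (-‿inverseʳ x)) e-zero)

  1+x≤e : ∀ {x} → 0# ≤ x → 1# + x ≤ e x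
  1+x≤e 0≤x = ≤-trans (1+x≤Exp 0≤x) (≤-reflexive (sym (e≈Exp 0≤x)))

  [1-u]*e≤1 : ∀ {u} → 0# ≤ u → u < 1# → (1# - u) * e u ≤ 1#
  [1-u]*e≤1 0≤u u<1 = ≤-trans (≤-reflexive (*-congˡ (e≈Exp 0≤u))) ([1-u]*Exp≤1 0≤u u<1)

  e-mono-≤ : ∀ {x y} → x ≤ y → e x ≤ e y
  e-mono-≤ {x} {y} x≤y = begin
    e x               ≈⟨ *-identityʳ _ ⟨
    e x * 1#          ≤⟨ *-monoˡ-≤ (0≤e x) (≤-trans (x≤x+y 0≤y-x) (1+x≤e 0≤y-x)) ⟩
    e x * e (y - x)   ≈⟨ e-+ x (y - x) ⟨
    e (x + (y - x))   ≈⟨ e-cong (solve 2 (λ x y → x :+ (y :- x) := y) refl x y) ⟩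
    e y               ∎
    where 0≤y-x = x≤y⇒0≤y-x x≤y

  e-sum : ∀ {n} (f : Fin n → R) → e (sum f) ≈ prod (e ∘ f)
  e-sum {zero}  f = e-zero
  e-sum {suc n} f = trans (e-+ _ _) (*-congˡ (e-sum (f ∘ suc)))

-- The sub-Gaussian bound on the hyperbolic cosine

module Hyperbolic (ℝ : Reals) (markov : MarkovPrinciple) where

  open RealAnalysis ℝ
  open OrderedField ℝ
  open Exponential ℝ markov
  open ≤-Reasoning

  -- Twice the hyperbolic cosine, which keeps the duplication formula free of fractions.
  cosh₂ : R → R
  cosh₂ y = e y + e (- y)

  cosh₂-cong : ∀ {x y} → x ≈ y → cosh₂ x ≈ cosh₂ y
  cosh₂-cong x≈y = +-cong (e-cong x≈y) (e-cong (-‿cong x≈y))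

  cosh₂-nonNegative : ∀ y → 0# ≤ cosh₂ y
  cosh₂-nonNegative y = +-nonNegative (0≤e y) (0≤e (- y))

  cosh₂-double : ∀ y → cosh₂ (y + y) ≈ cosh₂ y * cosh₂ y - fromℕ 2
  cosh₂-double y = begin-equality
    e (y + y) + e (- (y + y))                ≈⟨ +-cong (e-+ y y) (trans (e-cong (sym (-‿+-comm y y))) (e-+ (- y) (- y))) ⟩
    z * z + w * w                            ≈⟨ solve 2 (λ z w → z :* z :+ w :* w := (z :+ w) :* (z :+ w) :- :2 :* (z :* w)) refl z w ⟩
    cosh₂ y * cosh₂ y - fromℕ 2 * (z * w)    ≈⟨ +-congˡ (-‿cong (trans (*-congˡ (e-inverse y)) (*-identityʳ _))) ⟩
    cosh₂ y * cosh₂ y - fromℕ 2              ∎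
    where
    z = e y
    w = e (- y)

  -- For κ > 1 the bound cosh y ≤ exp (κ y² / 2) holds near 0 by the linear bounds on e,
  -- and it propagates from y to 2 y because 2 G² - 1 ≤ G⁴.
  module _ {κ : R} (1<κ : 1# < κ) where

    private
      bound : R → R
      bound y = ½ * (κ * (y * y))

      0<κ : 0# < κ
      0<κ = <-≤-trans 0<1 (proj₁ 1<κ)

      -- The largest `y` with `1 ≤ (1 - y) κ`; up to there `(1 - y) e y ≤ 1` yields `e y ≤ κ`.
      y₀ : R
      y₀ = 1# - κ ⁻¹

      0<y₀ : 0# < y₀
      0<y₀ = x<y⇒0<y-x (<-resp (*-identityʳ _) (trans (*-comm _ _) (⁻¹-inverse 0<κ)) (*-monoˡ-< (⁻¹-pos 0<κ) 1<κ))

      y₀<1 : y₀ < 1#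
      y₀<1 = <-via (solve 1 (λ i → :1 :- (:1 :- i) := i :- :0) refl (κ ⁻¹)) (⁻¹-pos 0<κ)

      cosh₂-near-zero : ∀ {y} → 0# ≤ y → y ≤ y₀ → cosh₂ y ≤ fromℕ 2 * e (bound y)
      cosh₂-near-zero {y} 0≤y y≤y₀ = begin
        -- Since `z w = 1`, the excess `z + w - 2` equals `(1 - w)² z`, where `1 - w ≤ y` and
        -- `z ≤ κ`.
        z + w                             ≈⟨ solve 2 (λ z w → z :+ w := (:1 :- w) :* (:1 :- w) :* z :+ :2 :* (z :* w) :+ w :* (:1 :- z :* w)) refl z w ⟩
        (1# - w) * (1# - w) * z + fromℕ 2 * (z * w) + w * (1# - z * w)
                                          ≈⟨ +-cong (+-congˡ (*-congˡ zw≈1)) (*-congˡ (trans (+-congˡ (-‿cong zw≈1)) (-‿inverseʳ 1#))) ⟩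
        (1# - w) * (1# - w) * z + fromℕ 2 * 1# + w * 0#
                                          ≈⟨ solve 2 (λ q w → q :+ :2 :* :1 :+ w :* :0 := :2 :+ q) refl ((1# - w) * (1# - w) * z) w ⟩
        fromℕ 2 + (1# - w) * (1# - w) * z ≤⟨ +-monoʳ-≤ (fromℕ 2) (*-mono-≤ (0≤x*x y) (0≤e y) (*-mono-≤ 0≤y 0≤1-w 1-w≤y 1-w≤y) z≤κ) ⟩
        fromℕ 2 + y * y * κ               ≈⟨ +-cong (sym (*-identityʳ _)) (trans (*-comm _ _) (sym (trans (sym (*-assoc _ _ _)) (trans (*-congʳ (⁻¹-inverse 0<2)) (*-identityˡ _))))) ⟩
        fromℕ 2 * 1# + fromℕ 2 * bound y  ≈⟨ distribˡ (fromℕ 2) 1# (bound y) ⟨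
        fromℕ 2 * (1# + bound y)          ≤⟨ *-monoˡ-≤ (proj₁ 0<2) (1+x≤e (*-nonNegative (proj₁ 0<½) (*-nonNegative (proj₁ 0<κ) (0≤x*x y)))) ⟩
        fromℕ 2 * e (bound y)             ∎
        where
        z = e y
        w = e (- y)
        zw≈1 = e-inverse y
        0<1-y : 0# < 1# - y
        0<1-y = x<y⇒0<y-x (≤-<-trans y≤y₀ y₀<1)
        [1-y]z≤1 : (1# - y) * z ≤ 1#
        [1-y]z≤1 = [1-u]*e≤1 0≤y (≤-<-trans y≤y₀ y₀<1)
        1≤[1-y]κ : 1# ≤ (1# - y) * κ
        1≤[1-y]κ = ≤-trans (≤-reflexive (sym (trans (*-comm _ _) (⁻¹-inverse 0<κ))))
          (*-monoʳ-≤ (proj₁ 0<κ) (≤-via (solve 2 (λ y i → :1 :- y :- i := :1 :- i :- y) refl y (κ ⁻¹)) y≤y₀))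
        z≤κ : z ≤ κ
        z≤κ = *-cancelˡ-≤ 0<1-y (≤-trans [1-y]z≤1 1≤[1-y]κ)
        0≤1-w : 0# ≤ 1# - w
        0≤1-w = x≤y⇒0≤y-x (≤-resp (*-identityˡ w) zw≈1 (*-monoʳ-≤ (0≤e (- y)) (≤-trans (x≤x+y 0≤y) (1+x≤e 0≤y))))
        1-w≤y : 1# - w ≤ y
        1-w≤y = ≤-via (solve 2 (λ w y → y :- (:1 :- w) := w :- (:1 :- y)) refl w y)
          (≤-resp (trans (*-assoc _ _ _) (trans (*-congˡ zw≈1) (*-identityʳ _))) (*-identityˡ w) (*-monoʳ-≤ (0≤e (- y)) [1-y]z≤1))

      cosh₂-doubling : ∀ {h} → cosh₂ h ≤ fromℕ 2 * e (bound h) → cosh₂ (h + h) ≤ fromℕ 2 * e (bound (h + h))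
      cosh₂-doubling {h} c≤2G = begin
        cosh₂ (h + h)                            ≈⟨ cosh₂-double h ⟩
        cosh₂ h * cosh₂ h - fromℕ 2              ≤⟨ +-monoˡ-≤ (- fromℕ 2) (*-mono-≤ (≤-trans (cosh₂-nonNegative h) c≤2G) (cosh₂-nonNegative h) c≤2G c≤2G) ⟩
        fromℕ 2 * G * (fromℕ 2 * G) - fromℕ 2    ≤⟨ ≤-from-difference (*-nonNegative (proj₁ 0<2) (0≤x*x (G * G - 1#)))
                                                      (solve 1 (λ g → :2 :* (g :* g :* (g :* g)) := :2 :* g :* (:2 :* g) :- :2 :+ :2 :* ((g :* g :- :1) :* (g :* g :- :1))) refl G) ⟩
        fromℕ 2 * (G * G * (G * G))              ≈⟨ *-congˡ (trans (*-cong (sym (e-+ b b)) (sym (e-+ b b))) (sym (e-+ _ _))) ⟩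
        fromℕ 2 * e (b + b + (b + b))            ≈⟨ *-congˡ (e-cong (solve 3 (λ a k h → a :* (k :* (h :* h)) :+ a :* (k :* (h :* h)) :+ (a :* (k :* (h :* h)) :+ a :* (k :* (h :* h))) := a :* (k :* ((h :+ h) :* (h :+ h)))) refl ½ κ h)) ⟩
        fromℕ 2 * e (bound (h + h))              ∎
        where
        b = bound h
        G = e b

      -- Halving serves as the induction step because `n + 2 ≤ 2 (n + 1)`. The linear scale lets
      -- `archimedean` supply `n` directly.
      cosh₂-≤-bounded : ∀ n {y} → 0# ≤ y → y ≤ y₀ * fromℕ (suc n) → cosh₂ y ≤ fromℕ 2 * e (bound y)
      cosh₂-≤-bounded zero    0≤y y≤ = cosh₂-near-zero 0≤y (≤-trans y≤ (≤-reflexive (trans (*-congˡ (+-identityʳ 1#)) (*-identityʳ _))))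
      cosh₂-≤-bounded (suc n) {y} 0≤y y≤ = ≤-resp (cosh₂-cong (halves y)) (*-congˡ (e-cong (*-congˡ (*-congˡ (*-cong (halves y) (halves y))))))
        (cosh₂-doubling (cosh₂-≤-bounded n (*-nonNegative (proj₁ 0<½) 0≤y) (begin
          ½ * y                                ≤⟨ *-monoˡ-≤ (proj₁ 0<½) (≤-trans y≤ (*-monoˡ-≤ (proj₁ 0<y₀) (≤-from-difference (fromℕ-nonNegative n)
                                                    (solve 1 (λ n → :2 :* (:1 :+ n) := :1 :+ (:1 :+ n) :+ n) refl (fromℕ n))))) ⟩
          ½ * (y₀ * (fromℕ 2 * fromℕ (suc n))) ≈⟨ solve 4 (λ a b c d → a :* (b :* (c :* d)) := c :* a :* (b :* d)) refl ½ y₀ (fromℕ 2) (fromℕ (suc n)) ⟩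
          fromℕ 2 * ½ * (y₀ * fromℕ (suc n))   ≈⟨ trans (*-congʳ (⁻¹-inverse 0<2)) (*-identityˡ _) ⟩
          y₀ * fromℕ (suc n)                   ∎)))

    cosh₂-≤-slack : ∀ {y} → 0# ≤ y → cosh₂ y ≤ fromℕ 2 * e (½ * (κ * (y * y)))
    cosh₂-≤-slack {y} 0≤y = cosh₂-≤-bounded n 0≤y (begin
      y                    ≈⟨ trans (sym (trans (*-congʳ (⁻¹-inverse 0<y₀)) (*-identityˡ y))) (*-assoc _ _ _) ⟩
      y₀ * (y₀ ⁻¹ * y)     ≤⟨ *-monoˡ-≤ (proj₁ 0<y₀) (≤-trans (proj₂ (archimedean (y₀ ⁻¹ * y))) (x≤y+x 0≤1)) ⟩
      y₀ * fromℕ (suc n)   ∎)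
      where n = proj₁ (archimedean (y₀ ⁻¹ * y))

  ½<1 : ½ < 1#
  ½<1 = <-resp refl ½+½≈1 (<-via (solve 1 (λ h → h :+ h :- h := h :- :0) refl ½) 0<½)

  private
    -- Removes the slack: suitable choices of `κ` give `c (1 - u) ≤ g` for every `u` strictly
    -- between 0 and 1, which is impossible for small `u` if `g < c`.
    cosh₂-≤-nonNeg : ∀ {y} → 0# ≤ y → cosh₂ y ≤ fromℕ 2 * e (½ * (y * y))
    cosh₂-≤-nonNeg {y} 0≤y = ≤-stable λ c≰g →
      let g<c = ≰⇒> c≰g
          0<c = ≤-<-trans 0≤g g<c
          -- Chosen so that `c (1 - v)` is the midpoint of `g` and `c`.
          v = ½ * (1# - g * c ⁻¹)
          cv≈ : c * (1# - v) ≈ c - ½ * (c - g)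
          cv≈ = trans (solve 4 (λ c h g i → c :* (:1 :- h :* (:1 :- g :* i)) := c :- h :* (c :- g :* (c :* i))) refl c ½ g (c ⁻¹))
            (+-congˡ (-‿cong (*-congˡ (+-congˡ (-‿cong (trans (*-congˡ (⁻¹-inverse 0<c)) (*-identityʳ g)))))))
          gap : 0# < ½ * (c - g)
          gap = *-pos 0<½ (x<y⇒0<y-x g<c)
          g<cv : g < c * (1# - v)
          g<cv = <-via (trans (+-congʳ cv≈) (trans (solve 3 (λ c g d → c :- d :- g := (c :- g :- (d :+ d)) :+ (d :- :0)) refl c g (½ * (c - g)))
            (trans (+-congʳ (x≈y⇒x-y≈0 (sym (halves (c - g))))) (+-identityˡ _)))) gap
          gi<1 : g * c ⁻¹ < 1#
          gi<1 = <-resp (*-comm _ _) (trans (*-comm _ _) (⁻¹-inverse 0<c)) (*-monoˡ-< (⁻¹-pos 0<c) g<c)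
          0<v : 0# < v
          0<v = *-pos 0<½ (x<y⇒0<y-x gi<1)
          v<1 : v < 1#
          v<1 = ≤-<-trans
            (≤-resp refl (*-identityʳ ½) (*-monoˡ-≤ (proj₁ 0<½)
              (≤-via (solve 1 (λ r → :1 :- (:1 :- r) := r :- :0) refl (g * c ⁻¹)) (*-nonNegative 0≤g (proj₁ (⁻¹-pos 0<c))))))
            ½<1
      in <⇒≱ g<cv (c[1-u]≤g 0<v v<1)
      where
      c = cosh₂ y
      w = ½ * (y * y)
      g = fromℕ 2 * e w
      0≤w : 0# ≤ w
      0≤w = *-nonNegative (proj₁ 0<½) (0≤x*x y)
      0≤g : 0# ≤ g
      0≤g = *-nonNegative (proj₁ 0<2) (0≤e w)
      c[1-u]≤g : ∀ {u} → 0# < u → u < 1# → c * (1# - u) ≤ g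
      c[1-u]≤g {u} 0<u u<1 = begin
        c * (1# - u)                          ≤⟨ *-monoʳ-≤ 0≤1-u (cosh₂-≤-slack 1<κ 0≤y) ⟩
        fromℕ 2 * e (½ * ((1# + θ) * (y * y))) * (1# - u)
                                              ≤⟨ *-monoʳ-≤ 0≤1-u (*-monoˡ-≤ (proj₁ 0<2) (e-mono-≤ exponent)) ⟩
        fromℕ 2 * e (w + u) * (1# - u)        ≈⟨ *-congʳ (*-congˡ (e-+ w u)) ⟩
        fromℕ 2 * (e w * e u) * (1# - u)      ≈⟨ solve 4 (λ t a b c → t :* (a :* b) :* c := t :* a :* (c :* b)) refl (fromℕ 2) (e w) (e u) (1# - u) ⟩
        g * ((1# - u) * e u)                  ≤⟨ *-monoˡ-≤ 0≤g ([1-u]*e≤1 (proj₁ 0<u) u<1) ⟩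
        g * 1#                                ≈⟨ *-identityʳ g ⟩
        g                                     ∎
        where
        0≤1-u = x≤y⇒0≤y-x (proj₁ u<1)
        0<1+w : 0# < 1# + w
        0<1+w = +-pos-nonNegative 0<1 0≤w
        i = (1# + w) ⁻¹
        -- The slack costs `θ w = u w / (1 + w) ≤ u` in the exponent, and a factor `e u` is absorbed
        -- by `1 - u`. The summand 1 keeps the denominator positive when `y` is 0.
        θ = u * i
        1<κ : 1# < 1# + θ
        1<κ = <-via (solve 1 (λ t → :1 :+ t :- :1 := t :- :0) refl θ) (*-pos 0<u (⁻¹-pos 0<1+w))
        exponent : ½ * ((1# + θ) * (y * y)) ≤ w + u
        exponent = ≤-from-difference (*-nonNegative (proj₁ 0<u) (proj₁ (⁻¹-pos 0<1+w)))
          (trans (+-congˡ (sym (trans (*-congˡ (⁻¹-inverse 0<1+w)) (*-identityʳ u))))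
            (solve 4 (λ h s u i → h :* s :+ u :* ((:1 :+ h :* s) :* i) := h :* ((:1 :+ u :* i) :* s) :+ u :* i) refl ½ (y * y) u i))

  cosh₂-≤ : ∀ y → cosh₂ y ≤ fromℕ 2 * e (½ * (y * y))
  cosh₂-≤ y with total 0# y
  ... | inj₁ 0≤y = cosh₂-≤-nonNeg 0≤y
  ... | inj₂ y≤0 = ≤-resp
    (trans (+-comm _ _) (+-congʳ (e-cong (-‿involutive y))))
    (*-congˡ (e-cong (*-congˡ (solve 1 (λ y → :- y :* :- y := y :* y) refl y))))
    (cosh₂-≤-nonNeg (≤-via (solve 1 (λ y → :- y :- :0 := :0 :- y) refl y) y≤0))

-- Summation over finite types of signs and sign matrices

module FiniteSummation (ℝ : Reals) where

  open RealAnalysis ℝ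
  open OrderedField ℝ

  -- A finite type enters only through the sum of functions on it; for Fin n → X this is an
  -- iterated sum, so that no function extensionality is needed.
  record Summation (X : Set) : Set where
    field
      Σ[_]    : (X → R) → R
      Σ-mono-≤  : ∀ {f g} → (∀ x → f x ≤ g x) → Σ[ f ] ≤ Σ[ g ]
      Σ-distrib-+ : ∀ f g → Σ[ (λ x → f x + g x) ] ≈ Σ[ f ] + Σ[ g ]
      Σ-scale   : ∀ c f → Σ[ (λ x → c * f x) ] ≈ c * Σ[ f ]

    Σ-cong : ∀ {f g} → (∀ x → f x ≈ g x) → Σ[ f ] ≈ Σ[ g ]
    Σ-cong f≈g = antisym (Σ-mono-≤ (≤-reflexive ∘ f≈g)) (Σ-mono-≤ (≤-reflexive ∘ sym ∘ f≈g))

    Σ-zero : Σ[ (λ _ → 0#) ] ≈ 0#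
    Σ-zero = trans (Σ-cong λ _ → sym (zeroˡ 0#)) (trans (Σ-scale 0# (λ _ → 0#)) (zeroˡ _))

    Σ-nonNegative : ∀ {f} → (∀ x → 0# ≤ f x) → 0# ≤ Σ[ f ]
    Σ-nonNegative 0≤f = ≤-trans (≤-reflexive (sym Σ-zero)) (Σ-mono-≤ 0≤f)

    Σ-∑ : ∀ n (f : Fin n → X → R) → Σ[ (λ x → ∑[ i < n ] f i x) ] ≈ ∑[ i < n ] Σ[ f i ]
    Σ-∑ zero    f = Σ-zero
    Σ-∑ (suc n) f = trans (Σ-distrib-+ (f zero) _) (+-congˡ (Σ-∑ n (f ∘ suc)))

  signs : Summation Sign
  signs = record
    { Σ[_]    = λ f → f Sign.+ + f Sign.-
    ; Σ-mono-≤  = λ f≤g → +-mono-≤ (f≤g Sign.+) (f≤g Sign.-)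
    ; Σ-distrib-+ = λ f g → solve 4 (λ a b c d → a :+ b :+ (c :+ d) := a :+ c :+ (b :+ d)) refl _ _ _ _
    ; Σ-scale   = λ c f → sym (distribˡ c _ _)
    }

  module _ {X : Set} (S : Summation X) where
    open Summation

    vectors : ∀ n → Summation (Fin n → X)
    vectors zero = record
      { Σ[_]    = λ f → f []
      ; Σ-mono-≤  = λ f≤g → f≤g []
      ; Σ-distrib-+ = λ _ _ → refl
      ; Σ-scale   = λ _ _ → refl
      }
    vectors (suc n) = record
      { Σ[_]    = λ f → Σ[ S ] λ x → Σ[ vectors n ] λ v → f (x ∷ v)
      ; Σ-mono-≤  = λ f≤g → Σ-mono-≤ S λ x → Σ-mono-≤ (vectors n) λ v → f≤g (x ∷ v)
      ; Σ-distrib-+ = λ f g → trans (Σ-cong S λ x → Σ-distrib-+ (vectors n) _ _) (Σ-distrib-+ S _ _)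
      ; Σ-scale   = λ c f → trans (Σ-cong S λ x → Σ-scale (vectors n) c _) (Σ-scale S c _)
      }

    -- Distributivity, playing the role of independence: an average of a product over separate
    -- coordinates factorises.
    Σ-prod : ∀ n (f : Fin n → X → R) → Σ[ vectors n ] (λ v → prod λ k → f k (v k)) ≈ prod λ k → Σ[ S ] (f k)
    Σ-prod zero    f = refl
    Σ-prod (suc n) f = trans
      (Σ-cong S λ x → trans (Σ-scale (vectors n) (f zero x) _) (trans (*-congˡ (Σ-prod n (f ∘ suc))) (*-comm _ _)))
      (trans (Σ-scale S _ (f zero)) (*-comm _ _))

-- Euclidean norms and the error of the estimator as a Rademacher chaos

module EstimatorError (ℝ : Reals) where

  open RealAnalysis ℝ
  open OrderedField ℝ
  open Sums ℝ
  open SquareRoot ℝ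
  open ≤-Reasoning

  sum-single : ∀ {n} {f : Fin n → R} (i : Fin n) → (∀ j → j ≢ i → f j ≈ 0#) → sum f ≈ f i
  sum-single zero    f≈0 = trans (+-congˡ (sum-zero λ j → f≈0 (suc j) λ ())) (+-identityʳ _)
  sum-single (suc i) f≈0 = trans (+-cong (f≈0 zero λ ()) (sum-single i λ j j≢i → f≈0 (suc j) (j≢i ∘ Fin.suc-injective)))
    (+-identityˡ _)

  fromSign-square : ∀ σ → fromSign σ * fromSign σ ≈ 1#
  fromSign-square Sign.+ = *-identityˡ 1#
  fromSign-square Sign.- = solve 0 (:- :1 :* :- :1 := :1) refl

  x^2≈x*x : ∀ x → x ^ 2 ≈ x * x
  x^2≈x*x x = *-congˡ (*-identityʳ x)

  squares : ∀ {n} → Vector R n → R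
  squares v = sum λ i → v i * v i

  squares-nonNegative : ∀ {n} (v : Vector R n) → 0# ≤ squares v
  squares-nonNegative v = sum-nonNegative λ i → 0≤x*x (v i)

  private
    0≤∑^2 : ∀ {n} (v : Vector R n) → 0# ≤ ∑[ i < n ] (v i ^ 2)
    0≤∑^2 v = ≤-trans (squares-nonNegative v) (≤-reflexive (sum-cong-≋ λ i → sym (x^2≈x*x (v i))))

  ‖‖-nonNegative : ∀ {n} (v : Vector R n) → 0# ≤ ‖ v ‖₂
  ‖‖-nonNegative v = sqrt-nonNegative (0≤∑^2 v)

  ‖‖-square : ∀ {n} (v : Vector R n) → ‖ v ‖₂ * ‖ v ‖₂ ≈ squares v
  ‖‖-square v = trans (sqrt-*-sqrt (0≤∑^2 v)) (sum-cong-≋ λ i → x^2≈x*x (v i))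

  ‖‖≤⇒squares≤ : ∀ {n} (v : Vector R n) {b} → ‖ v ‖₂ ≤ b → squares v ≤ b * b
  ‖‖≤⇒squares≤ v v≤b = ≤-trans (≤-reflexive (sym (‖‖-square v)))
    (*-mono-≤ (≤-trans (‖‖-nonNegative v) v≤b) (‖‖-nonNegative v) v≤b v≤b)

  squares≤⇒‖‖≤ : ∀ {n} (v : Vector R n) {b} → 0# ≤ b → squares v ≤ b * b → ‖ v ‖₂ ≤ b
  squares≤⇒‖‖≤ v 0≤b v²≤b² = square-cancel-≤ 0≤b (≤-trans (≤-reflexive (‖‖-square v)) v²≤b²)

  -- A Rademacher chaos of order two in which every product within a query shares the `i`-th sign.
  -- With the off-diagonal part of row `i` as weights it is `s` times the `i`-th error.
  chaos : ∀ {s n} → Vector R n → Fin n → (Fin s → Fin n → Sign) → R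
  chaos {s} {n} b i σ = ∑[ k < s ] ∑[ j < n ] (b j * (fromSign (σ k i) * fromSign (σ k j)))

  module _ {n : ℕ} (A : Matrix n n) where

    -- Zeroing the diagonal instead of deleting an index keeps every row sum over all of `Fin n`.
    offDiagonal : Matrix n n
    offDiagonal i j with j Fin.≟ i
    ... | yes _ = 0#
    ... | no _  = A i j

    offDiagonal-diag : ∀ i → offDiagonal i i ≈ 0#
    offDiagonal-diag i with i Fin.≟ i
    ... | yes _  = refl
    ... | no i≢i = ⊥-elim (i≢i ≡.refl)

    offDiagonal-off : ∀ i j → j ≢ i → offDiagonal i j ≈ A i j
    offDiagonal-off i j j≢i with j Fin.≟ i
    ... | yes j≡i = ⊥-elim (j≢i j≡i)
    ... | no _    = refl

    private
      sum-split : ∀ i (f g : Fin n → R) → g i ≈ 0# → (∀ j → j ≢ i → g j ≈ f j) → sum f ≈ sum g + f i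
      sum-split i f g gᵢ≈0 g≈f = begin-equality
        sum f                             ≈⟨ sum-cong-≋ (λ j → solve 2 (λ f g → f := g :+ (f :- g)) refl (f j) (g j)) ⟩
        ∑[ j < n ] (g j + (f j - g j))    ≈⟨ ∑-distrib-+ g (λ j → f j - g j) ⟩
        sum g + ∑[ j < n ] (f j - g j)    ≈⟨ +-congˡ (sum-single i λ j j≢i → x≈y⇒x-y≈0 (sym (g≈f j j≢i))) ⟩
        sum g + (f i - g i)               ≈⟨ +-congˡ (trans (+-congˡ (trans (-‿cong gᵢ≈0) -0≈0)) (+-identityʳ _)) ⟩
        sum g + f i                       ∎

    frobenius-offDiagonal : ‖ A ‖F ^ 2 - ‖ diag A ‖₂ ^ 2 ≈ ∑[ i < n ] squares (offDiagonal i)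
    frobenius-offDiagonal = begin-equality
      ‖ A ‖F ^ 2 - ‖ diag A ‖₂ ^ 2
        ≈⟨ +-cong (trans (x^2≈x*x _) (sqrt-*-sqrt (sum-nonNegative λ i → 0≤∑^2 (A i)))) (-‿cong (trans (x^2≈x*x _) (‖‖-square (diag A)))) ⟩
      ∑[ i < n ] ∑[ j < n ] (A i j ^ 2) - squares (diag A)
        ≈⟨ +-congʳ (sum-cong-≋ λ i → trans (sum-cong-≋ λ j → x^2≈x*x (A i j))
             (sum-split i (λ j → A i j * A i j) (λ j → offDiagonal i j * offDiagonal i j)
               (trans (*-congʳ (offDiagonal-diag i)) (zeroˡ _))
               (λ j j≢i → *-cong (offDiagonal-off i j j≢i) (offDiagonal-off i j j≢i)))) ⟩
      ∑[ i < n ] (squares (offDiagonal i) + A i i * A i i) - squares (diag A)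
        ≈⟨ +-congʳ (∑-distrib-+ (squares ∘ offDiagonal) (λ i → A i i * A i i)) ⟩
      ∑[ i < n ] squares (offDiagonal i) + squares (diag A) - squares (diag A)
        ≈⟨ solve 2 (λ s d → s :+ d :- d := s) refl (∑[ i < n ] squares (offDiagonal i)) (squares (diag A)) ⟩
      ∑[ i < n ] squares (offDiagonal i) ∎

    module _ {s : ℕ} where

      estimate : (Fin s → Fin n → Sign) → Vector R n
      estimate σ i = 1# / fromℕ s * ∑[ k < s ] (((fromSign ∘ σ k) ⊙ (A *ᵥ (fromSign ∘ σ k))) i)

      -- Signs square to 1, so each query reproduces `A i i` exactly and only the off-diagonal
      -- entries contribute to the error.
      estimate-error : .{{NonZero s}} → ∀ σ i → fromℕ s * (estimate σ -ᵥ diag A) i ≈ chaos (offDiagonal i) i σ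
      estimate-error σ i = begin-equality
        N * (1# / N * T - A i i)
          ≈⟨ solve 4 (λ n i t a → n :* (:1 :* i :* t :- a) := n :* i :* t :- n :* a) refl N (N ⁻¹) T (A i i) ⟩
        N * N ⁻¹ * T - N * A i i
          ≈⟨ +-congʳ (trans (*-congʳ (⁻¹-inverse (fromℕ-pos s))) (*-identityˡ T)) ⟩
        T - N * A i i
          ≈⟨ +-congʳ (sum-cong-≋ row) ⟩
        ∑[ k < s ] (c k + A i i) - N * A i i
          ≈⟨ +-cong (∑-distrib-+ c (λ _ → A i i)) (-‿cong (sym (sum-const s (A i i)))) ⟩
        sum c + ∑[ k < s ] A i i - ∑[ k < s ] A i i
          ≈⟨ solve 2 (λ c a → c :+ a :- a := c) refl (sum c) (∑[ k < s ] A i i) ⟩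
        chaos (offDiagonal i) i σ ∎
        where
        N = fromℕ s
        T = ∑[ k < s ] (((fromSign ∘ σ k) ⊙ (A *ᵥ (fromSign ∘ σ k))) i)
        c : Fin s → R
        c k = ∑[ j < n ] (offDiagonal i j * (fromSign (σ k i) * fromSign (σ k j)))
        row : ∀ k → fromSign (σ k i) * ∑[ j < n ] (A i j * fromSign (σ k j)) ≈ c k + A i i
        row k = begin-equality
          fromSign (σ k i) * ∑[ j < n ] (A i j * fromSign (σ k j))
            ≈⟨ *-distribˡ-sum (fromSign (σ k i)) (λ j → A i j * fromSign (σ k j)) ⟩
          ∑[ j < n ] (fromSign (σ k i) * (A i j * fromSign (σ k j)))
            ≈⟨ sum-cong-≋ (λ j → solve 3 (λ a b c → a :* (b :* c) := b :* (a :* c)) refl (fromSign (σ k i)) (A i j) (fromSign (σ k j))) ⟩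
          ∑[ j < n ] (A i j * (fromSign (σ k i) * fromSign (σ k j)))
            ≈⟨ sum-split i (λ j → A i j * (fromSign (σ k i) * fromSign (σ k j)))
                 (λ j → offDiagonal i j * (fromSign (σ k i) * fromSign (σ k j)))
                 (trans (*-congʳ (offDiagonal-diag i)) (zeroˡ _)) (λ j j≢i → *-congʳ (offDiagonal-off i j j≢i)) ⟩
          c k + A i i * (fromSign (σ k i) * fromSign (σ k i))
            ≈⟨ +-congˡ (trans (*-congˡ (fromSign-square (σ k i))) (*-identityʳ _)) ⟩
          c k + A i i ∎

      chaos-zero : ∀ i → squares (offDiagonal i) ≤ 0# → ∀ (σ : Fin s → Fin n → Sign) → chaos (offDiagonal i) i σ ≈ 0#
      chaos-zero i ≤0 σ = sum-zero {s} λ k → sum-zero {n} λ j → trans (*-congʳ (entry j)) (zeroˡ _)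
        where
        entry : ∀ j → offDiagonal i j ≈ 0#
        entry j = square-zero (≤-trans (term≤sum (λ j → 0≤x*x (offDiagonal i j)) j) ≤0)

-- Exponential moments of the error

module Moment (ℝ : Reals) (markov : MarkovPrinciple) where

  open RealAnalysis ℝ
  open OrderedField ℝ
  open Sums ℝ
  open Exponential ℝ markov
  open Hyperbolic ℝ markov
  open FiniteSummation ℝ
  open EstimatorError ℝ using (chaos)
  open Summation
  open ≤-Reasoning

  ½*cosh₂-≤ : ∀ y → ½ * e y + ½ * e (- y) ≤ e (½ * (y * y))
  ½*cosh₂-≤ y = begin
    ½ * e y + ½ * e (- y)              ≈⟨ distribˡ ½ _ _ ⟨
    ½ * cosh₂ y                        ≤⟨ *-monoˡ-≤ (proj₁ 0<½) (cosh₂-≤ y) ⟩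
    ½ * (fromℕ 2 * e (½ * (y * y)))    ≈⟨ trans (sym (*-assoc _ _ _)) (trans (*-congʳ (trans (*-comm _ _) (⁻¹-inverse 0<2))) (*-identityˡ _)) ⟩
    e (½ * (y * y))                    ∎

  -- The diagonal coefficient vanishes, so conditioning on the i-th sign leaves independent factors.
  module _ {n : ℕ} (c : Fin n → R) (i : Fin n) (cᵢ≈0 : c i ≈ 0#) where

    private
      indicator : Sign → Sign → R
      indicator Sign.+ Sign.+ = 1#
      indicator Sign.+ Sign.- = 0#
      indicator Sign.- Sign.+ = 0#
      indicator Sign.- Sign.- = 1#

      indicator-refl : ∀ τ → indicator τ τ ≈ 1#
      indicator-refl Sign.+ = refl
      indicator-refl Sign.- = refl

      indicator-nonNegative : ∀ τ σ → 0# ≤ indicator τ σ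
      indicator-nonNegative Sign.+ Sign.+ = 0≤1
      indicator-nonNegative Sign.+ Sign.- = ≤-refl
      indicator-nonNegative Sign.- Sign.+ = ≤-refl
      indicator-nonNegative Sign.- Sign.- = 0≤1

      indicator-total : ∀ τ → indicator τ Sign.+ + indicator τ Sign.- ≈ 1#
      indicator-total Sign.+ = +-identityʳ 1#
      indicator-total Sign.- = +-identityˡ 1#

      factor : Fin n → Sign → Sign → R
      factor j τ σ = e (c j * (fromSign τ * fromSign σ))

      -- The factors after fixing the `i`-th sign to `τ`. The indicator at `i` makes the product
      -- vanish on all other sign vectors; elsewhere `τ` replaces the common sign, so each factor
      -- depends on its own coordinate only.
      conditioned : Sign → Fin n → Sign → R
      conditioned τ j σ with j Fin.≟ i
      ... | yes _ = ½ * indicator τ σ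
      ... | no _  = ½ * factor j τ σ

      conditioned-nonNegative : ∀ τ j σ → 0# ≤ conditioned τ j σ
      conditioned-nonNegative τ j σ with j Fin.≟ i
      ... | yes _ = *-nonNegative (proj₁ 0<½) (indicator-nonNegative τ σ)
      ... | no _  = *-nonNegative (proj₁ 0<½) (0≤e _)

      factor-sum : ∀ j τ → ½ * factor j τ Sign.+ + ½ * factor j τ Sign.- ≤ e (½ * (c j * c j))
      factor-sum j Sign.+ = ≤-trans (≤-reflexive (+-cong
        (*-congˡ (e-cong (solve 1 (λ c → c :* (:1 :* :1) := c) refl (c j))))
        (*-congˡ (e-cong (solve 1 (λ c → c :* (:1 :* :- :1) := :- c) refl (c j)))))) (½*cosh₂-≤ (c j))
      factor-sum j Sign.- = ≤-trans (≤-reflexive (trans (+-comm _ _) (+-cong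
        (*-congˡ (e-cong (solve 1 (λ c → c :* (:- :1 :* :- :1) := c) refl (c j))))
        (*-congˡ (e-cong (solve 1 (λ c → c :* (:- :1 :* :1) := :- c) refl (c j))))))) (½*cosh₂-≤ (c j))

      bound : Fin n → R
      bound j = e (½ * (c j * c j))

      conditioned-sum-at : ∀ τ → conditioned τ i Sign.+ + conditioned τ i Sign.- ≤ ½ * bound i
      conditioned-sum-at τ with i Fin.≟ i
      ... | no i≢i = ⊥-elim (i≢i ≡.refl)
      ... | yes _  = begin
        ½ * indicator τ Sign.+ + ½ * indicator τ Sign.-   ≈⟨ distribˡ ½ _ _ ⟨
        ½ * (indicator τ Sign.+ + indicator τ Sign.-)     ≈⟨ *-congˡ (indicator-total τ) ⟩
        -- The factor `bound i ≥ 1` is inserted so that the final product runs over all coordinates.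
        ½ * 1#                                            ≤⟨ *-monoˡ-≤ (proj₁ 0<½) (≤-trans (x≤x+y 0≤ec²) (1+x≤e 0≤ec²)) ⟩
        ½ * bound i                                       ∎
        where 0≤ec² = *-nonNegative (proj₁ 0<½) (0≤x*x (c i))

      conditioned-sum-off : ∀ τ j → j ≢ i → conditioned τ j Sign.+ + conditioned τ j Sign.- ≤ bound j
      conditioned-sum-off τ j j≢i with j Fin.≟ i
      ... | yes j≡i = ⊥-elim (j≢i j≡i)
      ... | no _    = factor-sum j τ

      -- Coordinate `i` contributes the probability ½ of the sign `τ`, which the sum over both signs
      -- later cancels.
      conditioned-total : ∀ τ → Σ[ vectors signs n ] (λ w → prod λ j → conditioned τ j (w j)) ≤ ½ * prod bound
      conditioned-total τ = ≤-trans (≤-reflexive (Σ-prod signs n (conditioned τ)))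
        (prod-scale-≤ i (proj₁ 0<½) (λ j → +-nonNegative (conditioned-nonNegative τ j _) (conditioned-nonNegative τ j _))
          (λ j → 0≤e _) (conditioned-sum-at τ) (conditioned-sum-off τ))

      rowProduct : (Fin n → Sign) → R
      rowProduct w = prod λ j → ½ * factor j (w i) (w j)

      rowProduct-≤-conditioned : ∀ w τ → w i ≡ τ → rowProduct w ≤ prod λ j → conditioned τ j (w j)
      rowProduct-≤-conditioned w τ ≡.refl = prod-mono-≤ (λ j → *-nonNegative (proj₁ 0<½) (0≤e _)) factor≤
        where
        factor≤ : ∀ j → ½ * factor j (w i) (w j) ≤ conditioned (w i) j (w j)
        factor≤ j with j Fin.≟ i
        ... | yes ≡.refl = ≤-reflexive (*-congˡ (trans (e-cong (trans (*-congʳ cᵢ≈0) (zeroˡ _))) (trans e-zero (sym (indicator-refl (w i))))))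
        ... | no _       = ≤-refl

      -- The summand for the actual sign `w i` already dominates, and the other one is nonnegative.
      rowProduct-≤ : ∀ w → rowProduct w ≤ prod (λ j → conditioned Sign.+ j (w j)) + prod (λ j → conditioned Sign.- j (w j))
      rowProduct-≤ w = split (w i) ≡.refl
        where
        0≤ : ∀ τ → 0# ≤ prod (λ j → conditioned τ j (w j))
        0≤ τ = prod-nonNegative λ j → conditioned-nonNegative τ j (w j)
        split : ∀ τ → w i ≡ τ → rowProduct w ≤ prod (λ j → conditioned Sign.+ j (w j)) + prod (λ j → conditioned Sign.- j (w j))
        split Sign.+ eq = ≤-trans (rowProduct-≤-conditioned w Sign.+ eq) (x≤x+y (0≤ Sign.-))
        split Sign.- eq = ≤-trans (rowProduct-≤-conditioned w Sign.- eq) (x≤y+x (0≤ Sign.+))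

    row-moment : Σ[ vectors signs n ] (λ w → prod λ j → ½ * e (c j * (fromSign (w i) * fromSign (w j)))) ≤ e (½ * ∑[ j < n ] (c j * c j))
    row-moment = begin
      Σ[ vectors signs n ] rowProduct
        ≤⟨ Σ-mono-≤ (vectors signs n) rowProduct-≤ ⟩
      Σ[ vectors signs n ] (λ w → prod (λ j → conditioned Sign.+ j (w j)) + prod (λ j → conditioned Sign.- j (w j)))
        ≈⟨ Σ-distrib-+ (vectors signs n) _ _ ⟩
      _ ≤⟨ +-mono-≤ (conditioned-total Sign.+) (conditioned-total Sign.-) ⟩
      ½ * prod bound + ½ * prod bound
        ≈⟨ halves (prod bound) ⟩
      prod bound
        ≈⟨ e-sum (λ j → ½ * (c j * c j)) ⟨
      e (∑[ j < n ] (½ * (c j * c j)))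
        ≈⟨ e-cong (*-distribˡ-sum ½ (λ j → c j * c j)) ⟨
      e (½ * ∑[ j < n ] (c j * c j)) ∎

  module _ (s n : ℕ) where

    signMatrices : Summation (Fin s → Fin n → Sign)
    signMatrices = vectors (vectors signs n) s

    -- The probability of one sign matrix, nested like the product in `independent`.
    weight : R
    weight = prod {s} λ _ → prod {n} λ _ → ½

  module _ {s n : ℕ} where

    -- The exponential turns the sum over queries into a product, so the moment is the `s`-th power
    -- of the one for a single query.
    chaos-moment : ∀ (b : Fin n → R) i → b i ≈ 0# → ∀ l →
      Σ[ signMatrices s n ] (λ σ → weight s n * e (l * chaos b i σ)) ≤ e (½ * (fromℕ s * (l * l * ∑[ j < n ] (b j * b j))))
    chaos-moment b i bᵢ≈0 l = begin
      Σ[ signMatrices s n ] (λ σ → weight s n * e (l * chaos b i σ))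
        ≈⟨ Σ-cong (signMatrices s n) factorise ⟩
      Σ[ signMatrices s n ] (λ σ → prod λ k → row (σ k))
        ≈⟨ Σ-prod (vectors signs n) s (λ _ → row) ⟩
      prod {s} (λ _ → Σ[ vectors signs n ] row)
        ≤⟨ prod-mono-≤ {s} (λ _ → Σ-nonNegative (vectors signs n) λ w → prod-nonNegative {n} λ j → *-nonNegative (proj₁ 0<½) (0≤e _))
             (λ _ → row-moment c i (trans (*-congˡ bᵢ≈0) (zeroʳ l))) ⟩
      prod {s} (λ _ → e a)
        ≈⟨ e-sum {s} (λ _ → a) ⟨
      e (∑[ k < s ] a)
        ≈⟨ e-cong (trans (sum-const s a) exponent) ⟩
      e (½ * (fromℕ s * (l * l * ∑[ j < n ] (b j * b j)))) ∎
      where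
      c : Fin n → R
      c j = l * b j
      a = ½ * ∑[ j < n ] (c j * c j)
      row : (Fin n → Sign) → R
      row w = prod λ j → ½ * e (c j * (fromSign (w i) * fromSign (w j)))
      exponent : fromℕ s * a ≈ ½ * (fromℕ s * (l * l * ∑[ j < n ] (b j * b j)))
      exponent = trans
        (*-congˡ (*-congˡ (trans (sum-cong-≋ λ j → solve 2 (λ l b → l :* b :* (l :* b) := l :* l :* (b :* b)) refl l (b j))
          (sym (*-distribˡ-sum (l * l) (λ j → b j * b j))))))
        (solve 3 (λ s h t → s :* (h :* t) := h :* (s :* t)) refl (fromℕ s) ½ (l * l * ∑[ j < n ] (b j * b j)))
      factorise : ∀ σ → weight s n * e (l * chaos b i σ) ≈ prod λ k → row (σ k)
      factorise σ = sym (begin-equality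
        prod (λ k → row (σ k))
          ≈⟨ prod-cong-≋ (λ k → prod-distrib-* (λ _ → ½) (λ j → e (x k j))) ⟩
        prod (λ k → prod {n} (λ _ → ½) * prod (λ j → e (x k j)))
          ≈⟨ prod-distrib-* (λ _ → prod {n} (λ _ → ½)) (λ k → prod (λ j → e (x k j))) ⟩
        weight s n * prod (λ k → prod (λ j → e (x k j)))
          ≈⟨ *-congˡ (trans (prod-cong-≋ λ k → sym (e-sum (x k))) (sym (e-sum λ k → sum (x k)))) ⟩
        weight s n * e (∑[ k < s ] ∑[ j < n ] x k j)
          ≈⟨ *-congˡ (e-cong (trans (sum-cong-≋ λ k → trans (sum-cong-≋ λ j → *-assoc l (b j) _) (sym (*-distribˡ-sum l (z k)))) (sym (*-distribˡ-sum l (λ k → sum (z k)))))) ⟩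
        weight s n * e (l * chaos b i σ) ∎)
        where
        x z : Fin s → Fin n → R
        x k j = c j * (fromSign (σ k i) * fromSign (σ k j))
        z k j = b j * (fromSign (σ k i) * fromSign (σ k j))

-- Elementary probability, Markov's principle, and total probability

module Probability (ℝ : Reals) (𝒫 : RealAnalysis.ProbabilitySpace ℝ) where

  open RealAnalysis ℝ
  open OrderedField ℝ
  open Sums ℝ
  open FiniteSummation ℝ
  open ProbabilitySpace 𝒫

  ⟶-cons : ∀ {a b c l} → (∀ m → b (suc m) ≈ c + a m) → a ⟶ l → b ⟶ c + l
  ⟶-cons {a} {b} {c} {l} b≈c+a a⟶l ε 0<ε = let N , near = a⟶l ε 0<ε in suc N , λ where
    (suc m) (ℕ.s≤s N≤m) →
      let shift : b (suc m) - (c + l) ≈ a m - l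
          shift = trans (+-congʳ (b≈c+a m)) (solve 3 (λ a c l → c :+ a :- (c :+ l) := a :- l) refl (a m) c l)
          below , above = near m N≤m
      in <-resp refl (sym shift) below , <-resp (sym shift) refl above

  ⟶-zero : ∀ {a} → (∀ m → a m ≈ 0#) → a ⟶ 0#
  ⟶-zero {a} a≈0 ε 0<ε = 0 , λ m _ →
    let a-0≈0 = trans (+-cong (a≈0 m) -0≈0) (+-identityˡ 0#) in
    <-resp refl (sym a-0≈0) (<-via (solve 1 (λ e → :0 :- :- e := e :- :0) refl ε) 0<ε) , <-resp (sym a-0≈0) refl 0<ε

  Event : Set₁
  Event = Pred Ω 0ℓ

  measurable-∅ : Measurable ∅
  measurable-∅ = measurable-≐ ((λ ¬tt → ¬tt tt) , λ ()) (measurable-∁ measurable-U)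

  -- For the constant sequence of empty events the partial sums converge to `p`; splitting off the
  -- first summand shows that they also converge to `p + p`.
  ℙ-∅ : ℙ ∅ ≈ 0#
  ℙ-∅ = sym (trans (trans (sym (-‿inverseʳ p)) (+-congʳ p≈p+p)) (solve 1 (λ p → p :+ p :- p := p) refl p))
    where
    p = ℙ ∅
    ∑p = λ m → ∑[ i < m ] p
    ∑p⟶p : ∑p ⟶ p
    ∑p⟶p ε 0<ε = let N , near = ℙ-σ-additive {λ _ → ∅} (λ _ → measurable-∅) (λ _ _ _ → proj₁) ε 0<ε in N , λ m N≤m →
      let union = ℙ-cong (measurable-⋃ {λ _ → ∅} (λ _ → measurable-∅)) (proj₂ , λ ())
          below , above = near m N≤m
      in <-resp refl (+-congˡ (-‿cong union)) below , <-resp (+-congˡ (-‿cong union)) refl above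
    p≈p+p : p ≈ p + p
    p≈p+p = ⟶-unique ∑p⟶p (⟶-cons (λ _ → refl) ∑p⟶p)

  private
    pair : Event → Event → ℕ → Event
    pair E F 0             = E
    pair E F 1             = F
    pair E F (suc (suc _)) = ∅

    measurable-pair : ∀ {E F} → Measurable E → Measurable F → ∀ i → Measurable (pair E F i)
    measurable-pair mE mF 0             = mE
    measurable-pair mE mF 1             = mF
    measurable-pair mE mF (suc (suc _)) = measurable-∅

    pair-⋃ : ∀ {E F} → ⋃ ℕ (pair E F) ≐ E ∪ F
    pair-⋃ = (λ { (0 , e) → inj₁ e ; (1 , f) → inj₂ f }) , [ (0 ,_) , (1 ,_) ]′

    pair-⊥ : ∀ {E F} → E ⊥ F → ∀ i j → i ≢ j → pair E F i ⊥ pair E F j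
    pair-⊥ E⊥F 0 0 i≢j _ = i≢j ≡.refl
    pair-⊥ E⊥F 0 1 i≢j (e , f) = E⊥F (e , f)
    pair-⊥ E⊥F 1 0 i≢j (f , e) = E⊥F (e , f)
    pair-⊥ E⊥F 1 1 i≢j _ = i≢j ≡.refl
    pair-⊥ E⊥F (suc (suc _)) j i≢j ()
    pair-⊥ E⊥F 0 (suc (suc _)) i≢j (_ , ())
    pair-⊥ E⊥F 1 (suc (suc _)) i≢j (_ , ())

  measurable-∪ : ∀ {E F} → Measurable E → Measurable F → Measurable (E ∪ F)
  measurable-∪ mE mF = measurable-≐ pair-⋃ (measurable-⋃ (measurable-pair mE mF))

  ℙ-∪ : ∀ {E F} → Measurable E → Measurable F → E ⊥ F → ℙ (E ∪ F) ≈ ℙ E + ℙ F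
  ℙ-∪ {E} {F} mE mF E⊥F = trans (sym (ℙ-cong (measurable-⋃ (measurable-pair mE mF)) pair-⋃))
    (trans (⟶-unique (ℙ-σ-additive (measurable-pair mE mF) (pair-⊥ E⊥F))
      (⟶-cons {a = λ m → ∑[ i < m ] ℙ (pair E F (suc (toℕ i)))} (λ _ → refl)
        (⟶-cons {a = λ m → ∑[ i < m ] ℙ ∅} (λ _ → refl) (⟶-zero λ m → sum-zero {m} λ _ → ℙ-∅))))
      (+-congˡ (+-identityʳ _)))

  measurable-const : ∀ {Q : Set} → Dec Q → Measurable (λ _ → Q)
  measurable-const (yes q) = measurable-≐ ((λ _ → q) , _) measurable-U
  measurable-const (no ¬q) = measurable-≐ ((λ ()) , ¬q) measurable-∅

  -- σ-additivity produces actual moduli of convergence, hence an unbounded search principle: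
  -- the events "n is the first index with Q n" are deterministic and exhaust Ω.
  module _ (Q : ℕ → Set) (Q? : ∀ n → Dec (Q n)) where

    First : ℕ → Set
    First n = Q n × (∀ j → j ℕ.< n → ¬ Q j)

    private
      extend : ∀ {n} → (∀ j → j ℕ.< n → ¬ Q j) → ¬ Q n → ∀ j → j ℕ.< suc n → ¬ Q j
      extend none ¬Qn j j<1+n with ℕ.m<1+n⇒m<n∨m≡n j<1+n
      ... | inj₁ j<n    = none j j<n
      ... | inj₂ ≡.refl = ¬Qn

    first-below : ∀ n → ∃ First ⊎ (∀ j → j ℕ.< n → ¬ Q j)
    first-below zero = inj₂ λ _ ()
    first-below (suc n) with first-below n
    ... | inj₁ found = inj₁ found
    ... | inj₂ none with Q? n
    ...   | yes Qn = inj₁ (n , Qn , none)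
    ...   | no ¬Qn = inj₂ (extend none ¬Qn)

    First? : ∀ n → Dec (First n)
    First? n with Q? n | first-below n
    ... | no ¬Qn | _ = no (¬Qn ∘ proj₁)
    ... | yes Qn | inj₂ none = yes (Qn , none)
    ... | yes Qn | inj₁ (k , Qk , below-k) with k ℕ.<? n
    ...   | yes k<n = no λ (_ , below-n) → below-n k k<n Qk
    ...   | no k≮n  = yes (Qn , λ j j<n → below-k j (ℕ.<-≤-trans j<n (ℕ.≮⇒≥ k≮n)))

    First-unique : ∀ {i j} → i ≢ j → First i → ¬ First j
    First-unique {i} {j} i≢j (Qi , below-i) (Qj , below-j) with ℕ.<-cmp i j
    ... | tri< i<j _ _ = below-j i i<j Qi
    ... | tri≈ _ i≡j _ = i≢j i≡j
    ... | tri> _ _ j<i = below-i j j<i Qj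

    markov : ¬ ¬ ∃ Q → ∃ Q
    -- The modulus `N` for tolerance 1 bounds the search: the whole union has probability 1, so the
    -- first `N` probabilities cannot all vanish.
    markov ¬¬∃Q with ℙ-σ-additive {λ n _ → First n} (λ n → measurable-const (First? n)) (λ _ _ i≢j (f , g) → First-unique i≢j f g) 1# 0<1
    ... | N , near with first-below N
    ...   | inj₁ (n , Qn , _) = n , Qn
    ...   | inj₂ none = ⊥-elim (<⇒≱ (proj₁ (near N ℕ.≤-refl)) (≤-reflexive
              (trans (+-cong (sum-zero {N} λ i → trans (ℙ-cong (measurable-const (First? (toℕ i)))
                  ((λ f → none (toℕ i) (Fin.toℕ<n i) (proj₁ f)) , λ ())) ℙ-∅) (-‿cong ℙ-⋃≈1)) (+-identityˡ _))))
      where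
      ℙ-⋃≈1 : ℙ (⋃ ℕ λ n _ → First n) ≈ 1#
      -- Equality of reals is decidable, so the doubly negated hypothesis is enough here.
      ℙ-⋃≈1 with ℙ (⋃ ℕ λ n _ → First n) ≟ 1#
      ... | yes ≈1 = ≈1
      ... | no ≉1 = ⊥-elim (¬¬∃Q λ (n , Qn) → ≉1 (trans
            (ℙ-cong (measurable-⋃ λ k → measurable-const (First? k))
              (_ , λ _ → [ (λ found → found) , (λ none → ⊥-elim (none n ℕ.≤-refl Qn)) ]′ (first-below (suc n))))
            ℙ-U))

  measurable-∩ : ∀ {E F : Event} → (∀ ω → Dec (E ω)) → (∀ ω → Dec (F ω)) → Measurable E → Measurable F → Measurable (E ∩ F)
  measurable-∩ {E} {F} E? F? mE mF = measurable-≐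
    ((λ {ω} → intro ω) , λ { (e , f) (inj₁ ¬e) → ¬e e ; (e , f) (inj₂ ¬f) → ¬f f })
    (measurable-∁ (measurable-∪ (measurable-∁ mE) (measurable-∁ mF)))
    where
    intro : ∀ ω → ¬ (¬ E ω ⊎ ¬ F ω) → E ω × F ω
    intro ω both with E? ω | F? ω
    ... | yes e | yes f = e , f
    ... | no ¬e | _     = ⊥-elim (both (inj₁ ¬e))
    ... | _     | no ¬f = ⊥-elim (both (inj₂ ¬f))

  measurable-∀ : ∀ n {E : Fin n → Event} → (∀ k ω → Dec (E k ω)) → (∀ k → Measurable (E k)) → Measurable (λ ω → ∀ k → E k ω)
  measurable-∀ zero    E? mE = measurable-≐ ((λ _ ()) , _) measurable-U
  measurable-∀ (suc n) E? mE = measurable-≐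
    ((λ { (e₀ , es) zero → e₀ ; (e₀ , es) (suc k) → es k }) , λ es → es zero , es ∘ suc)
    (measurable-∩ (E? zero) (λ ω → Fin.all? λ k → E? (suc k) ω) (mE zero) (measurable-∀ n (E? ∘ suc) (mE ∘ suc)))

  ℙ-∁ : ∀ {E} → (∀ ω → Dec (E ω)) → Measurable E → ℙ E + ℙ (∁ E) ≈ 1#
  ℙ-∁ {E} E? mE = trans (sym (ℙ-∪ mE (measurable-∁ mE) λ (e , ¬e) → ¬e e))
    (trans (ℙ-cong (measurable-∪ mE (measurable-∁ mE)) (_ , λ {ω} _ → decide (E? ω))) ℙ-U)
    where
    decide : ∀ {ω} → Dec (E ω) → (E ∪ ∁ E) ω
    decide (yes e) = inj₁ e
    decide (no ¬e) = inj₂ ¬e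

  open Summation

  -- Measurability of `E` is part of the conclusion, so an event only has to be examined cell by
  -- cell.
  TotalProbability : ∀ {X} → Summation X → (X → Event) → Set₁
  TotalProbability S P = ∀ E → (∀ x → Measurable (E ∩ P x)) → Measurable E × ℙ E ≈ Σ[ S ] λ x → ℙ (E ∩ P x)

  totalProbability-signs : (W : Ω → Sign) → TotalProbability signs (λ σ ω → W ω ≡ σ)
  totalProbability-signs W E mE = measurable-≐ E≐ m∪ , trans (sym (ℙ-cong m∪ E≐)) (ℙ-∪ (mE Sign.+) (mE Sign.-) disjoint)
    where
    m∪ = measurable-∪ (mE Sign.+) (mE Sign.-)
    E≐ : (E ∩ λ ω → W ω ≡ Sign.+) ∪ (E ∩ λ ω → W ω ≡ Sign.-) ≐ E
    E≐ = [ proj₁ , proj₁ ]′ , λ {ω} e → split e (W ω) ≡.refl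
      where
      split : ∀ {ω} → E ω → ∀ σ → W ω ≡ σ → ((E ∩ λ ω → W ω ≡ Sign.+) ∪ (E ∩ λ ω → W ω ≡ Sign.-)) ω
      split e Sign.+ eq = inj₁ (e , eq)
      split e Sign.- eq = inj₂ (e , eq)
    disjoint : (E ∩ λ ω → W ω ≡ Sign.+) ⊥ (E ∩ λ ω → W ω ≡ Sign.-)
    disjoint ((_ , W≡+) , (_ , W≡-)) with ≡.trans (≡.sym W≡+) W≡-
    ... | ()

  totalProbability-vectors : ∀ {X} (S : Summation X) n (P : Fin n → X → Event) → (∀ k → TotalProbability S (P k)) →
    TotalProbability (vectors S n) (λ v ω → ∀ k → P k (v k) ω)
  totalProbability-vectors S zero P total E mE =
    measurable-≐ E≐ (mE []) , sym (ℙ-cong (mE []) E≐)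
    where
    E≐ : (E ∩ λ ω → ∀ k → P k ([] k) ω) ≐ E
    E≐ = proj₁ , λ e → e , λ ()
  totalProbability-vectors S (suc n) P total E mE =
    proj₁ here , trans (proj₂ here) (Σ-cong S λ x → trans (proj₂ (rest x)) (Σ-cong (vectors S n) λ v → sym (ℙ-cong (mE (x ∷ v)) (E≐ x v))))
    where
    E≐ : ∀ x v → (E ∩ λ ω → ∀ k → P k ((x ∷ v) k) ω) ≐ ((E ∩ P zero x) ∩ λ ω → ∀ k → P (suc k) (v k) ω)
    E≐ x v = (λ (e , p) → (e , p zero) , p ∘ suc) , λ ((e , p₀) , p) → e , λ { zero → p₀ ; (suc k) → p k }
    rest = λ x → totalProbability-vectors S n (P ∘ suc) (total ∘ suc) (E ∩ P zero x) λ v → measurable-≐ (E≐ x v) (mE (x ∷ v))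
    here = total zero E λ x → proj₁ (rest x)

-- From averages over sign matrices to probabilities

module Outcomes (ℝ : Reals) (𝒫 : RealAnalysis.ProbabilitySpace ℝ) where

  open RealAnalysis ℝ
  open Estimator 𝒫
  open OrderedField ℝ
  open Sums ℝ
  open FiniteSummation ℝ
  open Summation
  open Probability ℝ 𝒫
  open Moment ℝ markov using (signMatrices; weight)
  open ≤-Reasoning

  module _ {s n : ℕ} {V : SignFamily s n} (iid : IsIIDRademacher V) where
    open IsIIDRademacher iid

    private
      Outcome : (Fin s → Fin n → Sign) → Event
      Outcome σ ω = ∀ k i → V k i ω ≡ σ k i

      measurable-Outcome : ∀ σ → Measurable (Outcome σ)
      measurable-Outcome σ = measurable-∀ s (λ k ω → Fin.all? λ i → V k i ω Sign.≟ σ k i)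
        λ k → measurable-∀ n (λ i ω → V k i ω Sign.≟ σ k i) λ i → measurable k i (σ k i)

      ℙ-Outcome : ∀ σ → ℙ (Outcome σ) ≈ weight s n
      ℙ-Outcome σ = trans (independent σ) (prod-cong-≋ {s} λ k → prod-cong-≋ {n} λ i → trans (uniform k i (σ k i)) (*-identityˡ _))

      total-outcome : TotalProbability (signMatrices s n) Outcome
      total-outcome = totalProbability-vectors (vectors signs n) s _ λ k →
        totalProbability-vectors signs n _ λ i → totalProbability-signs (V k i)

    -- Markov's inequality for a weight `W` that dominates the indicator of failure. As `Q` decides
    -- `Good` on each outcome, the complement of `Good` meets a cell either fully or not at all,
    -- which gives both its measurability and its probability.
    ℙ-≥ : ∀ {Good : Event} (Q : (Fin s → Fin n → Sign) → Set) → (∀ σ → Dec (Q σ)) →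
      (∀ σ ω → Outcome σ ω → Q σ → Good ω) → (∀ σ ω → Outcome σ ω → Good ω → Q σ) →
      (∀ ω → Dec (Good ω)) →
      ∀ (W : (Fin s → Fin n → Sign) → R) {δ} → (∀ σ → 0# ≤ W σ) → (∀ σ → ¬ Q σ → 1# ≤ W σ) →
      Σ[ signMatrices s n ] (λ σ → weight s n * W σ) ≤ δ → 1# - δ ≤ ℙ Good
    ℙ-≥ {Good} Q Q? Q⇒Good Good⇒Q Good? W {δ} 0≤W 1≤W ΣW≤δ = begin
      1# - δ                             ≤⟨ +-monoʳ-≤ 1# (-‿mono-≤ ℙBad≤δ) ⟩
      1# - ℙ (∁ Good)                    ≈⟨ +-congʳ (ℙ-∁ Good? measurable-Good) ⟨
      ℙ Good + ℙ (∁ Good) - ℙ (∁ Good)   ≈⟨ solve 2 (λ g b → g :+ b :- b := g) refl (ℙ Good) (ℙ (∁ Good)) ⟩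
      ℙ Good                             ∎
      where
      bad-≐ : ∀ σ → ¬ Q σ → Outcome σ ≐ (∁ Good ∩ Outcome σ)
      bad-≐ σ ¬q = (λ {ω} o → ¬q ∘ Good⇒Q σ ω o , o) , proj₂
      good-≐ : ∀ σ → Q σ → ∅ ≐ (∁ Good ∩ Outcome σ)
      good-≐ σ q = (λ ()) , λ {ω} (¬g , o) → ¬g (Q⇒Good σ ω o q)
      measurable-cell : ∀ σ → Measurable (∁ Good ∩ Outcome σ)
      measurable-cell σ with Q? σ
      ... | yes q = measurable-≐ (good-≐ σ q) measurable-∅
      ... | no ¬q = measurable-≐ (bad-≐ σ ¬q) (measurable-Outcome σ)
      0≤weight : 0# ≤ weight s n
      0≤weight = prod-nonNegative {s} λ _ → prod-nonNegative {n} λ _ → proj₁ 0<½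
      ℙ-cell : ∀ σ → ℙ (∁ Good ∩ Outcome σ) ≤ weight s n * W σ
      ℙ-cell σ with Q? σ
      ... | yes q = ≤-trans (≤-reflexive (trans (sym (ℙ-cong measurable-∅ (good-≐ σ q))) ℙ-∅)) (*-nonNegative 0≤weight (0≤W σ))
      ... | no ¬q = ≤-trans (≤-reflexive (trans (sym (ℙ-cong (measurable-Outcome σ) (bad-≐ σ ¬q))) (ℙ-Outcome σ)))
                      (≤-resp (*-identityʳ _) refl (*-monoˡ-≤ 0≤weight (1≤W σ ¬q)))
      bad = total-outcome (∁ Good) measurable-cell
      ℙBad≤δ : ℙ (∁ Good) ≤ δ
      ℙBad≤δ = ≤-trans (≤-reflexive (proj₂ bad)) (≤-trans (Σ-mono-≤ (signMatrices s n) ℙ-cell) ΣW≤δ)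
      stable : ∀ {ω} → Dec (Good ω) → ¬ ¬ Good ω → Good ω
      stable (yes g) _ = g
      stable (no ¬g) ¬¬g = ⊥-elim (¬¬g ¬g)
      measurable-Good : Measurable Good
      measurable-Good = measurable-≐ ((λ {ω} → stable (Good? ω)) , λ g ¬g → ¬g g) (measurable-∁ (proj₁ bad))

-- Chernoff bounds and the union bound

module Tail (ℝ : Reals) (markov : MarkovPrinciple) where

  open RealAnalysis ℝ
  open OrderedField ℝ
  open Sums ℝ
  open SquareRoot ℝ
  open FiniteSummation ℝ
  open Summation
  open EstimatorError ℝ
  open Exponential ℝ markov
  open Hyperbolic ℝ markov
  open Moment ℝ markov
  open ≤-Reasoning

  module _ {s n : ℕ} .{{_ : NonZero s}} (A : Matrix n n) {τ : R} (0≤τ : 0# ≤ τ) where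

    variance : Fin n → R
    variance i = squares (offDiagonal A i)

    -- The Gaussian tail exponent: a chaos of variance `s v` at deviation `s √(τ v)` gives `s τ / 2`
    -- for every `v`.
    exponent : R
    exponent = ½ * (fromℕ s * τ)

    -- The optimal Chernoff parameter for the deviation s √τ √(variance i);
    -- at variance 0 it is a junk value, but then the i-th error vanishes.
    parameter : Fin n → R
    parameter i = sqrt τ * sqrt (variance i) ⁻¹

    -- Both Chernoff tails at once. At the threshold the exponential reaches `exp (2 x)`, with `x`
    -- the `exponent`, and is scaled back to 1; its mean is at most `exp x`, so each tail costs
    -- `exp (- x)`.
    penalty : Fin n → (Fin s → Fin n → Sign) → R
    penalty i σ = e (- (exponent + exponent)) * cosh₂ (parameter i * chaos (offDiagonal A i) i σ)

    penalty-nonNegative : ∀ i σ → 0# ≤ penalty i σ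
    penalty-nonNegative i σ = *-nonNegative (0≤e _) (cosh₂-nonNegative _)

    private
      0≤s : 0# ≤ fromℕ s
      0≤s = fromℕ-nonNegative s

      0≤variance : ∀ i → 0# ≤ variance i
      0≤variance i = squares-nonNegative (offDiagonal A i)

      0<root : ∀ i → ¬ (variance i ≤ 0#) → 0# < sqrt (variance i)
      0<root i v≰0 = ≰⇒> λ r≤0 → v≰0 (≤-resp (sqrt-*-sqrt (0≤variance i)) (zeroˡ 0#)
        (*-mono-≤ ≤-refl (sqrt-nonNegative (0≤variance i)) r≤0 r≤0))

      parameter-root : ∀ i → ¬ (variance i ≤ 0#) → parameter i * sqrt (variance i) ≈ sqrt τ
      parameter-root i v≰0 = trans (*-assoc _ _ _)
        (trans (*-congˡ (trans (*-comm _ _) (⁻¹-inverse (0<root i v≰0)))) (*-identityʳ _))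

      parameter²-variance : ∀ i → parameter i * parameter i * variance i ≤ τ
      parameter²-variance i with variance i ≤? 0#
      ... | yes v≤0 = ≤-trans (*-monoˡ-≤ (0≤x*x (parameter i)) v≤0) (≤-trans (≤-reflexive (zeroʳ _)) 0≤τ)
      ... | no v≰0  = ≤-reflexive (begin-equality
        l * l * variance i          ≈⟨ *-congˡ (sqrt-*-sqrt (0≤variance i)) ⟨
        l * l * (r * r)             ≈⟨ solve 2 (λ l r → l :* l :* (r :* r) := l :* r :* (l :* r)) refl l r ⟩
        l * r * (l * r)             ≈⟨ *-cong (parameter-root i v≰0) (parameter-root i v≰0) ⟩
        sqrt τ * sqrt τ             ≈⟨ sqrt-*-sqrt 0≤τ ⟩
        τ                           ∎)
        where
        l = parameter i
        r = sqrt (variance i)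

      moment-≤ : ∀ i l → l * l * variance i ≤ τ →
        Σ[ signMatrices s n ] (λ σ → weight s n * e (l * chaos (offDiagonal A i) i σ)) ≤ e exponent
      moment-≤ i l l²v≤τ = ≤-trans (chaos-moment {s} (offDiagonal A i) i (offDiagonal-diag A i) l)
        (e-mono-≤ (*-monoˡ-≤ (proj₁ 0<½) (*-monoˡ-≤ 0≤s l²v≤τ)))

    penalty-mean : ∀ i → Σ[ signMatrices s n ] (λ σ → weight s n * penalty i σ) ≤ fromℕ 2 * e (- exponent)
    penalty-mean i = begin
      Σ[ signMatrices s n ] (λ σ → μ * penalty i σ)
        ≈⟨ Σ-cong (signMatrices s n) (λ σ → trans
             (solve 4 (λ m a b c → m :* (a :* (b :+ c)) := a :* (m :* b :+ m :* c)) refl μ E⁻² _ _)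
             (*-congˡ (+-congˡ (*-congˡ (e-cong (solve 2 (λ l y → :- (l :* y) := :- l :* y) refl l (chaos (offDiagonal A i) i σ))))))) ⟩
      Σ[ signMatrices s n ] (λ σ → E⁻² * (μ * e (l * chaos (offDiagonal A i) i σ) + μ * e (- l * chaos (offDiagonal A i) i σ)))
        ≈⟨ trans (Σ-scale (signMatrices s n) E⁻² _) (*-congˡ (Σ-distrib-+ (signMatrices s n) _ _)) ⟩
      E⁻² * (Σ[ signMatrices s n ] (λ σ → μ * e (l * chaos (offDiagonal A i) i σ)) + Σ[ signMatrices s n ] (λ σ → μ * e (- l * chaos (offDiagonal A i) i σ)))
        ≤⟨ *-monoˡ-≤ (0≤e _) (+-mono-≤ (moment-≤ i l (parameter²-variance i))
             (moment-≤ i (- l) (≤-trans (≤-reflexive (*-congʳ (solve 1 (λ l → :- l :* :- l := l :* l) refl l))) (parameter²-variance i)))) ⟩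
      E⁻² * (e exponent + e exponent)
        ≈⟨ solve 2 (λ a b → a :* (b :+ b) := :2 :* (a :* b)) refl E⁻² (e exponent) ⟩
      fromℕ 2 * (E⁻² * e exponent)
        ≈⟨ *-congˡ (trans (sym (e-+ _ _)) (e-cong (solve 1 (λ x → :- (x :+ x) :+ x := :- x) refl exponent))) ⟩
      fromℕ 2 * e (- exponent) ∎
      where
      μ = weight s n
      l = parameter i
      E⁻² = e (- (exponent + exponent))

    penalty-detects : ∀ i σ → fromℕ s * fromℕ s * (τ * variance i) < chaos (offDiagonal A i) i σ * chaos (offDiagonal A i) i σ →
      1# ≤ penalty i σ
    penalty-detects i σ deviates with variance i ≤? 0#
    -- A row without variance has no error, so a strict deviation is impossible and the junk
    -- parameter is never consulted.
    ... | yes v≤0 = ⊥-elim (<⇒≱ deviates (≤-trans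
          (≤-reflexive (trans (*-congʳ (chaos-zero A i v≤0 σ)) (zeroˡ _)))
          (*-nonNegative (0≤x*x (fromℕ s)) (*-nonNegative 0≤τ (0≤variance i)))))
    ... | no v≰0 = detect (square-< (≤-<-trans (≤-reflexive threshold²) deviates))
      where
      y = chaos (offDiagonal A i) i σ
      l = parameter i
      r = sqrt (variance i)
      threshold = fromℕ s * (sqrt τ * r)
      threshold² : threshold * threshold ≈ fromℕ s * fromℕ s * (τ * variance i)
      threshold² = trans (solve 3 (λ s q r → s :* (q :* r) :* (s :* (q :* r)) := s :* s :* (q :* q :* (r :* r))) refl (fromℕ s) (sqrt τ) r)
        (*-congˡ (*-cong (sqrt-*-sqrt 0≤τ) (sqrt-*-sqrt (0≤variance i))))
      0≤l : 0# ≤ l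
      0≤l = *-nonNegative (sqrt-nonNegative 0≤τ) (proj₁ (⁻¹-pos (0<root i v≰0)))
      l*threshold : l * threshold ≈ exponent + exponent
      l*threshold = begin-equality
        l * (fromℕ s * (sqrt τ * r))      ≈⟨ solve 4 (λ l s q r → l :* (s :* (q :* r)) := s :* (q :* (l :* r))) refl l (fromℕ s) (sqrt τ) r ⟩
        fromℕ s * (sqrt τ * (l * r))      ≈⟨ *-congˡ (trans (*-congˡ (parameter-root i v≰0)) (sqrt-*-sqrt 0≤τ)) ⟩
        fromℕ s * τ                       ≈⟨ halves _ ⟨
        exponent + exponent               ∎
      reach : ∀ z → threshold ≤ z → 1# ≤ e (- (exponent + exponent)) * e (l * z)
      reach z t≤z = begin
        1#                                                            ≈⟨ e-inverse _ ⟨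
        e (exponent + exponent) * e (- (exponent + exponent))         ≈⟨ *-comm _ _ ⟩
        e (- (exponent + exponent)) * e (exponent + exponent)         ≤⟨ *-monoˡ-≤ (0≤e _) (e-mono-≤ (≤-trans (≤-reflexive (sym l*threshold)) (*-monoˡ-≤ 0≤l t≤z))) ⟩
        e (- (exponent + exponent)) * e (l * z)                       ∎
      detect : (threshold ≤ y) ⊎ (threshold ≤ - y) → 1# ≤ penalty i σ
      detect (inj₁ t≤y) = ≤-trans (reach y t≤y) (*-monoˡ-≤ (0≤e _) (x≤x+y (0≤e _)))
      detect (inj₂ t≤-y) = ≤-trans (reach (- y) t≤-y) (*-monoˡ-≤ (0≤e _)
        (≤-trans (≤-reflexive (e-cong (solve 2 (λ l y → l :* :- y := :- (l :* y)) refl l y))) (x≤y+x (0≤e _))))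

    totalPenalty : (Fin s → Fin n → Sign) → R
    totalPenalty σ = ∑[ i < n ] penalty i σ

    totalPenalty-nonNegative : ∀ σ → 0# ≤ totalPenalty σ
    totalPenalty-nonNegative σ = sum-nonNegative λ i → penalty-nonNegative i σ

    totalPenalty-mean : Σ[ signMatrices s n ] (λ σ → weight s n * totalPenalty σ) ≤ fromℕ n * (fromℕ 2 * e (- exponent))
    totalPenalty-mean = begin
      Σ[ signMatrices s n ] (λ σ → μ * totalPenalty σ)
        ≈⟨ Σ-cong (signMatrices s n) (λ σ → *-distribˡ-sum μ (λ i → penalty i σ)) ⟩
      Σ[ signMatrices s n ] (λ σ → ∑[ i < n ] (μ * penalty i σ))
        ≈⟨ Σ-∑ (signMatrices s n) n (λ i σ → μ * penalty i σ) ⟩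
      ∑[ i < n ] Σ[ signMatrices s n ] (λ σ → μ * penalty i σ)
        ≤⟨ sum-mono-≤ penalty-mean ⟩
      ∑[ i < n ] (fromℕ 2 * e (- exponent))
        ≈⟨ sum-const n _ ⟩
      fromℕ n * (fromℕ 2 * e (- exponent)) ∎
      where μ = weight s n

    -- A pigeonhole argument: if every coordinate stayed within its share `τ * variance i`, the
    -- total squared error would stay within the budget.
    totalPenalty-detects : ∀ σ → ¬ (squares (estimate A σ -ᵥ diag A) ≤ τ * ∑[ i < n ] variance i) → 1# ≤ totalPenalty σ
    totalPenalty-detects σ far = ≤-stable λ small → far (*-cancelˡ-≤ 0<s² (begin
      fromℕ s * fromℕ s * squares x
        ≈⟨ *-distribˡ-sum (fromℕ s * fromℕ s) (λ i → x i * x i) ⟩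
      ∑[ i < n ] (fromℕ s * fromℕ s * (x i * x i))
        ≈⟨ sum-cong-≋ (λ i → trans (solve 2 (λ s x → s :* s :* (x :* x) := s :* x :* (s :* x)) refl (fromℕ s) (x i))
             (*-cong (estimate-error A σ i) (estimate-error A σ i))) ⟩
      ∑[ i < n ] (y i * y i)
        ≤⟨ sum-mono-≤ (λ i → ≤-stable λ deviates → small (≤-trans (penalty-detects i σ (≰⇒> deviates)) (term≤sum (λ i → penalty-nonNegative i σ) i))) ⟩
      ∑[ i < n ] (fromℕ s * fromℕ s * (τ * variance i))
        ≈⟨ *-distribˡ-sum (fromℕ s * fromℕ s) (λ i → τ * variance i) ⟨
      fromℕ s * fromℕ s * ∑[ i < n ] (τ * variance i)
        ≈⟨ *-congˡ (*-distribˡ-sum τ variance) ⟨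
      fromℕ s * fromℕ s * (τ * ∑[ i < n ] variance i) ∎))
      where
      x = estimate A σ -ᵥ diag A
      y : Fin n → R
      y i = chaos (offDiagonal A i) i σ
      0<s² = *-pos (fromℕ-pos s) (fromℕ-pos s)

-- Transfer from sign matrices to the estimator

module Concentration (ℝ : Reals) (𝒫 : RealAnalysis.ProbabilitySpace ℝ) where

  open RealAnalysis ℝ
  open Estimator 𝒫
  open OrderedField ℝ
  open Sums ℝ
  open FiniteSummation ℝ
  open Summation
  open EstimatorError ℝ
  open Probability ℝ 𝒫 using (markov)
  open Moment ℝ markov
  open Outcomes ℝ 𝒫

  module _ {n : ℕ} (A : Matrix n n) {ε̄ : R} (0<ε̄ : 0# < ε̄) where

    private
      radius : R
      radius = ε̄ * ‖ diag A ‖₂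

      0≤radius : 0# ≤ radius
      0≤radius = *-nonNegative (proj₁ 0<ε̄) (‖‖-nonNegative (diag A))

      Close : ∀ {s} → (Fin s → Fin n → Sign) → Set
      Close σ = squares (estimate A σ -ᵥ diag A) ≤ radius * radius

    -- On each outcome the estimator is `estimate A σ`, and because the radius is nonnegative the
    -- norm bound is equivalent to a bound on squares.
    ℙ-close-≥ : ∀ {s} {V : SignFamily s n} → IsIIDRademacher V → ∀ W {δ} →
      (∀ σ → 0# ≤ W σ) → (∀ σ → ¬ Close σ → 1# ≤ W σ) → Σ[ signMatrices s n ] (λ σ → weight s n * W σ) ≤ δ →
      1# - δ ≤ ℙ (λ ω → ‖ rademacherEstimator A V ω -ᵥ diag A ‖₂ ≤ radius)
    ℙ-close-≥ {s} {V} iid = ℙ-≥ iid Close (λ σ → _ ≤? _)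
      (λ σ ω V≡σ close → squares≤⇒‖‖≤ (rademacherEstimator A V ω -ᵥ diag A) 0≤radius (≤-trans (≤-reflexive (squares-V ω σ V≡σ)) close))
      (λ σ ω V≡σ near → ≤-trans (≤-reflexive (sym (squares-V ω σ V≡σ))) (‖‖≤⇒squares≤ (rademacherEstimator A V ω -ᵥ diag A) near))
      (λ ω → _ ≤? _)
      where
      squares-V : ∀ ω σ → (∀ k i → V k i ω ≡ σ k i) →
        squares (rademacherEstimator A V ω -ᵥ diag A) ≈ squares (estimate A σ -ᵥ diag A)
      squares-V ω σ V≡σ = sum-cong-≋ λ i → *-cong (error i) (error i)
        where
        sign : ∀ k i → fromSign (V k i ω) ≈ fromSign (σ k i)
        sign k i = reflexive (≡.cong fromSign (V≡σ k i))
        error : ∀ i → (rademacherEstimator A V ω -ᵥ diag A) i ≈ (estimate A σ -ᵥ diag A) i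
        error i = +-congʳ (*-congˡ (sum-cong-≋ λ k → *-cong (sign k i) (sum-cong-≋ λ j → *-congˡ (sign k j))))

-- Calibration of the tail bound by the hypothesis on the number of queries

mainTheorem8 : (ℝ : Reals) → let open RealAnalysis ℝ in
    (𝒫 : ProbabilitySpace) → let open Estimator 𝒫 in
    (n : ℕ) (A : Matrix n n) →
    ¬ (∀ i → diag A i ≈ 0#) →
    (ε̄ δ : R) → 0# < ε̄ → 0# < δ → δ < 1# →
    (s : ℕ) → .{{NonZero s}} →
    fromℕ 2 * ((‖ A ‖F ^ 2 - ‖ diag A ‖₂ ^ 2) / ‖ diag A ‖₂ ^ 2)
    * (ln (fromℕ 2 * fromℕ n / δ) / ε̄ ^ 2) < fromℕ s →
    (V : SignFamily s n) → IsIIDRademacher V →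
    1# - δ ≤ ℙ (λ ω → ‖ rademacherEstimator A V ω -ᵥ diag A ‖₂ ≤ ε̄ * ‖ diag A ‖₂)
-- In dimension 0 the diagonal vanishes vacuously.
mainTheorem8 ℝ 𝒫 zero A diag≉0 = ⊥-elim (diag≉0 λ ())
mainTheorem8 ℝ 𝒫 n@(suc n-1) A diag≉0 ε̄ δ 0<ε̄ 0<δ δ<1 s s> V iid = conclude (S ≤? 0#)
  where
  open RealAnalysis ℝ
  open Estimator 𝒫
  open OrderedField ℝ
  open Sums ℝ
  open FiniteSummation ℝ
  open Summation
  open EstimatorError ℝ
  open Probability ℝ 𝒫 using (markov)
  open Exponential ℝ markov
  open Moment ℝ markov
  open Tail ℝ markov
  open Concentration ℝ 𝒫
  open ≤-Reasoning

  D S : R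
  D = squares (diag A)
  S = ∑[ i < n ] squares (offDiagonal A i)

  radius : R
  radius = ε̄ * ‖ diag A ‖₂

  radius² : radius * radius ≈ ε̄ * ε̄ * D
  radius² = trans (solve 2 (λ e d → e :* d :* (e :* d) := e :* e :* (d :* d)) refl ε̄ ‖ diag A ‖₂)
    (*-congˡ (‖‖-square (diag A)))

  0<D : 0# < D
  0<D = ≰⇒> λ D≤0 → diag≉0 λ i → square-zero (≤-trans (term≤sum (λ i → 0≤x*x (diag A i)) i) D≤0)

  conclude : Dec (S ≤ 0#) → 1# - δ ≤ ℙ (λ ω → ‖ rademacherEstimator A V ω -ᵥ diag A ‖₂ ≤ radius)
  -- For a diagonal matrix `τ` would divide by 0, but every estimate is exact and the zero weight
  -- suffices.
  conclude (yes S≤0) = ℙ-close-≥ A 0<ε̄ iid (λ _ → 0#) (λ _ → ≤-refl)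
    (λ σ far → ⊥-elim (far (≤-trans (≤-reflexive (exact σ)) (0≤x*x radius))))
    (≤-trans (≤-reflexive (trans (Σ-cong (signMatrices s n) λ σ → zeroʳ _) (Σ-zero (signMatrices s n)))) (proj₁ 0<δ))
    where
    exact : ∀ σ → squares (estimate A {s} σ -ᵥ diag A) ≈ 0#
    exact σ = sum-zero {n} λ i → trans (*-congˡ {x = (estimate A σ -ᵥ diag A) i} (error≈0 i)) (zeroʳ _)
      where
      error≈0 : ∀ i → (estimate A σ -ᵥ diag A) i ≈ 0#
      error≈0 i = *-cancelˡ (fromℕ-pos s) (trans (estimate-error A σ i) (trans
        (chaos-zero A i (≤-trans (term≤sum (λ i → squares-nonNegative (offDiagonal A i)) i) S≤0) σ) (sym (zeroʳ _))))
  conclude (no S≰0) = ℙ-close-≥ A 0<ε̄ iid (totalPenalty {s} A 0≤τ) (totalPenalty-nonNegative A 0≤τ)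
    (λ σ far → totalPenalty-detects A 0≤τ σ λ near → far (≤-trans near (≤-reflexive τS≈radius²)))
    (≤-trans (totalPenalty-mean {s} A 0≤τ) mean≤δ)
    where
    0<S : 0# < S
    0<S = ≰⇒> S≰0

    τ : R
    -- Solves `τ S = radius²`, so that the budgets of the coordinates exhaust the admissible squared
    -- error.
    τ = ε̄ * ε̄ * D * S ⁻¹

    0<τ : 0# < τ
    0<τ = *-pos (*-pos (*-pos 0<ε̄ 0<ε̄) 0<D) (⁻¹-pos 0<S)

    0≤τ : 0# ≤ τ
    0≤τ = proj₁ 0<τ

    τS≈radius² : τ * S ≈ radius * radius
    τS≈radius² = trans (*-assoc _ _ _) (trans (*-congˡ (trans (*-comm _ _) (⁻¹-inverse 0<S)))
      (trans (*-identityʳ _) (sym radius²)))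

    x y : R
    x = ½ * (fromℕ s * τ)
    y = fromℕ 2 * fromℕ n / δ

    0≤x : 0# ≤ x
    0≤x = *-nonNegative (proj₁ 0<½) (*-nonNegative (fromℕ-nonNegative s) 0≤τ)

    -- Here `n ≥ 1` and `δ < 1` enter, putting `y` in the range where `ln<⇒<Exp` applies.
    1≤y : 1# ≤ y
    1≤y = *-cancelˡ-≤ 0<δ (begin
      δ * 1#                    ≈⟨ *-identityʳ δ ⟩
      δ                         ≤⟨ proj₁ δ<1 ⟩
      1#                        ≤⟨ ≤-from-difference (+-nonNegative 0≤1 (*-nonNegative (proj₁ 0<2) (fromℕ-nonNegative n-1)))
                                     (solve 1 (λ m → :2 :* (:1 :+ m) := :1 :+ (:1 :+ :2 :* m)) refl (fromℕ n-1)) ⟩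
      fromℕ 2 * fromℕ n         ≈⟨ δy≈2n ⟨
      δ * y                     ∎)
      where
      δy≈2n : δ * y ≈ fromℕ 2 * fromℕ n
      δy≈2n = trans (solve 3 (λ d m i → d :* (m :* i) := m :* (d :* i)) refl δ (fromℕ 2 * fromℕ n) (δ ⁻¹))
        (trans (*-congˡ (⁻¹-inverse 0<δ)) (*-identityʳ _))

    0<ε̄² : 0# < ε̄ * ε̄
    0<ε̄² = *-pos 0<ε̄ 0<ε̄

    ln<x : ln y < x
    -- Multiplying the hypothesis on `s` by `½ * τ`, the reciprocal of the coefficient of `ln y`,
    -- isolates the logarithm.
    ln<x = <-resp
      (begin-equality
        ½ * τ * (fromℕ 2 * ((‖ A ‖F ^ 2 - ‖ diag A ‖₂ ^ 2) / ‖ diag A ‖₂ ^ 2) * (ln y / ε̄ ^ 2))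
          ≈⟨ *-congˡ (*-cong (*-congˡ (*-cong (frobenius-offDiagonal A) (⁻¹-cong (trans (x^2≈x*x _) (‖‖-square (diag A))))))
               (*-congˡ (⁻¹-cong (x^2≈x*x ε̄)))) ⟩
        ½ * τ * (fromℕ 2 * (S * D ⁻¹) * (ln y * (ε̄ * ε̄) ⁻¹))
          ≈⟨ solve 9 (λ h q d si t s di l qi → h :* (q :* d :* si) :* (t :* (s :* di) :* (l :* qi)) := t :* h :* (q :* qi) :* (d :* di) :* (s :* si) :* l) refl
               ½ (ε̄ * ε̄) D (S ⁻¹) (fromℕ 2) S (D ⁻¹) (ln y) ((ε̄ * ε̄) ⁻¹) ⟩
        fromℕ 2 * ½ * (ε̄ * ε̄ * (ε̄ * ε̄) ⁻¹) * (D * D ⁻¹) * (S * S ⁻¹) * ln y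
          ≈⟨ *-congʳ (*-cong (*-cong (*-cong (⁻¹-inverse 0<2) (⁻¹-inverse 0<ε̄²)) (⁻¹-inverse 0<D)) (⁻¹-inverse 0<S)) ⟩
        1# * 1# * 1# * 1# * ln y
          ≈⟨ solve 1 (λ l → :1 :* :1 :* :1 :* :1 :* l := l) refl (ln y) ⟩
        ln y ∎)
      (solve 3 (λ h t s → h :* t :* s := h :* (s :* t)) refl ½ τ (fromℕ s))
      (*-monoˡ-< (*-pos 0<½ 0<τ) s>)

    mean≤δ : fromℕ n * (fromℕ 2 * e (- x)) ≤ δ
    mean≤δ = begin
      fromℕ n * (fromℕ 2 * e (- x))     ≈⟨ trans (solve 3 (λ m t w → m :* (t :* w) := t :* m :* w) refl (fromℕ n) (fromℕ 2) (e (- x)))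
                                             (sym (trans (*-congˡ (⁻¹-inverse 0<δ)) (*-identityʳ _))) ⟩
      fromℕ 2 * fromℕ n * e (- x) * (δ * δ ⁻¹)
                                        ≈⟨ solve 4 (λ m w d i → m :* w :* (d :* i) := d :* (m :* i :* w)) refl (fromℕ 2 * fromℕ n) (e (- x)) δ (δ ⁻¹) ⟩
      δ * (y * e (- x))                 ≤⟨ *-monoˡ-≤ (proj₁ 0<δ) (*-monoʳ-≤ (0≤e _) (≤-trans (proj₁ (ln<⇒<Exp 0≤x 1≤y ln<x)) (≤-reflexive (sym (e≈Exp 0≤x))))) ⟩
      δ * (e x * e (- x))               ≈⟨ *-congˡ (e-inverse x) ⟩
      δ * 1#                            ≈⟨ *-identityʳ δ ⟩
      δ                                 ∎
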